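{- Let $q>2$, $k\mid n$, and let $\mathcal S$ be a set of $q^k+1$ elements of $\mathcal D$. The following are equivalent: (1) $\mathcal S=\phi(m)$ for some $\mathbb{F}_{q^k}$-subline $m$ contained in $l_\infty$; (2) for any three elements of $\mathcal S$, the unique regulus containing them is contained in $\mathcal S$; (3) there is a $(2k-1)$-dimensional subspace of $H_\infty$ meeting each element of $\mathcal S$ in a $(k-1)$-dimensional subspace; (4) there is a $(2k-1)$-dimensional subspace of $H_\infty$ meeting each element of $\mathcal S$ in a $(k-1)$-dimensional subspace belonging to $\mathcal D_k$.
   Context: Let $q$ be a prime power and $n\ge1$. Points of $\mathrm{PG}(2,q^n)$ are written $(a,b,c)_{\mathbb{F}_{q^n}}$; $l_\infty$ is the line $c=0$. An $\mathbb{F}_{q^k}$-subline ($k\mid n$) is a set $\{(su+tv)_{\mathbb{F}_{q^n}}:(s,t)\in\mathbb{F}_{q^k}^2\setminus\{(0,0)\}\}$ for $\mathbb{F}_{q^n}$-independent $u,v\in\mathbb{F}_{q^n}^3$. Let $H_\infty=\mathrm{PG}(2n-1,q)$ be the projective space of the $\mathbb{F}_q$-vector space $\mathbb{F}_{q^n}^2$, points $(a,b,0)_{\mathbb{F}_q}$. For $k\mid n$, $\mathcal D_k=\{\{(ax,bx,0)_{\mathbb{F}_q}:x\in\mathbb{F}_{q^k}^*\}:(a,b)\in\mathbb{F}_{q^n}^2\setminus\{(0,0)\}\}$ and $\mathcal D=\mathcal D_n$ (a Desarguesian $(n-1)$-spread). The map $\phi$ sends a point $(a,b,0)_{\mathbb{F}_{q^n}}$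 of $l_\infty$ to $\{(ax,bx,0)_{\mathbb{F}_q}:x\in\mathbb{F}_{q^n}^*\}\in\mathcal D$. A regulus is a set $\mathcal R$ of $(n-1)$-spaces in a $(2n-1)$-space such that every line meeting three elements of $\mathcal R$ meets all elements of $\mathcal R$; any three pairwise disjoint $(n-1)$-spaces spanning a $(2n-1)$-space lie in a unique regulus of $q+1$ elements. -}

module Defs where

open import Level using (Level; _⊔_; suc)
open import Algebra.Bundles using (CommutativeRing)
import Algebra.Definitions as AlgebraDefinitions
import Algebra.Properties.CommutativeMonoid.Sum as CommutativeMonoidSum
open import Data.Fin.Base using (Fin)
open import Data.Fin.Patterns using (0F; 1F; 2F)
open import Data.Nat.Base as ℕ using (ℕ)
open import Data.Nat.Primality using (Prime)
open import Data.Product.Base using (Σ-syntax; ∃; ∃-syntax; ∃₂; _×_; _,_; proj₁; proj₂)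
open import Data.Unit.Polymorphic.Base using (⊤)
open import Data.Vec.Functional using (Vector; []; _∷_)
import Data.Vec.Functional.Relation.Binary.Equality.Setoid as VectorEquality
open import Function.Base using (id; _∘_)
open import Function.Bundles using (Bijection; _⇔_)
open import Relation.Binary.Bundles using (Setoid)
import Relation.Binary.Construct.On as On
open import Relation.Binary.PropositionalEquality.Core using (_≡_)
import Relation.Binary.PropositionalEquality.Properties as ≡
import Relation.Binary.Reasoning.Setoid as ≈-Reasoning
open import Relation.Nullary.Negation using (¬_)
open import Relation.Unary using (Pred; _≬_)

IsPrimePower : ℕ → Set
IsPrimePower q = ∃₂ λ p e → Prime p × e ℕ.≥ 1 × q ≡ p ℕ.^ e

HasSize : ∀ {a ℓ} → Setoid a ℓ → ℕ → Set (a ⊔ ℓ)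
HasSize A N = Bijection (≡.setoid (Fin N)) A

------------------------------------------------------------------------
-- Subsets of a setoid
--
-- Points, sets of points and sets of subspaces are all compared up to a
-- nontrivial equality, so a subset is a predicate respecting it.

record Subset {a ℓ} (A : Setoid a ℓ) (p : Level) : Set (a ⊔ ℓ ⊔ suc p) where
  open Setoid A
  field
    member  : Pred Carrier p
    respect : ∀ {x y} → x ≈ y → member x → member y

open Subset public

module _ {a ℓ} {A : Setoid a ℓ} where

  open Setoid A using (Carrier)

  infix 4 _∈_ _⊆_ _≐_
  infixr 7 _∩_

  _∈_ : ∀ {p} → Carrier → Subset A p → Set p
  x ∈ X = member X x

  _⊆_ : ∀ {p r} → Subset A p → Subset A r → Set (a ⊔ p ⊔ r)
  X ⊆ Y = ∀ x → x ∈ X → x ∈ Y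

  _≐_ : ∀ {p r} → Subset A p → Subset A r → Set (a ⊔ p ⊔ r)
  X ≐ Y = X ⊆ Y × Y ⊆ X

  _∩_ : ∀ {p r} → Subset A p → Subset A r → Subset A (p ⊔ r)
  X ∩ Y = record
    { member  = λ x → x ∈ X × x ∈ Y
    ; respect = λ x≈y (x∈X , x∈Y) → respect X x≈y x∈X , respect Y x≈y x∈Y
    }

  Meets : ∀ {p r} → Subset A p → Subset A r → Set (a ⊔ p ⊔ r)
  Meets X Y = member X ≬ member Y

  elements : ∀ {p} → Subset A p → Setoid (a ⊔ p) ℓ
  elements X = On.setoid {B = ∃ (member X)} A proj₁

subsets : ∀ {a ℓ} → Setoid a ℓ → (p : Level) → Setoid (a ⊔ ℓ ⊔ suc p) (a ⊔ p)
subsets A p = record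
  { Carrier       = Subset A p
  ; _≈_           = _≐_
  ; isEquivalence = record
    { refl  = (λ _ → id) , (λ _ → id)
    ; sym   = λ (f , g) → g , f
    ; trans = λ (f , g) (f′ , g′) → (λ x → f′ x ∘ f x) , (λ x → g x ∘ g′ x)
    }
  }

------------------------------------------------------------------------
-- Fields and subfields

record Field c ℓ : Set (suc (c ⊔ ℓ)) where
  field
    commutativeRing : CommutativeRing c ℓ
  open CommutativeRing commutativeRing public
  open AlgebraDefinitions _≈_ using (Invertible)
  field
    1≉0     : ¬ 1# ≈ 0#
    inverse : ∀ x → ¬ x ≈ 0# → Invertible 1# _*_ x

module _ {c ℓ} (𝔽 : Field c ℓ) where

  open Field 𝔽

  record Subfield : Set (suc (c ⊔ ℓ)) where
    field
      subset   : Subset setoid (c ⊔ ℓ)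
      0-closed : 0# ∈ subset
      1-closed : 1# ∈ subset
      +-closed : ∀ {x y} → x ∈ subset → y ∈ subset → x + y ∈ subset
      neg-closed : ∀ {x} → x ∈ subset → - x ∈ subset
      *-closed : ∀ {x y} → x ∈ subset → y ∈ subset → x * y ∈ subset
      inverse-closed : ∀ {x y} → x ∈ subset → x * y ≈ 1# → y ∈ subset

module Geometry {c ℓ} (𝔽 : Field c ℓ) where

  open Field 𝔽
  open VectorEquality setoid using (_≋_)
  open CommutativeMonoidSum +-commutativeMonoid using (sum)
  open Subfield using (subset; 1-closed; *-closed; inverse-closed)

  private L = c ⊔ ℓ

  infix 4 _∈ₖ_
  _∈ₖ_ : Carrier → Subfield 𝔽 → Set L
  x ∈ₖ K = x ∈ subset K

  whole : Subfield 𝔽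
  whole = record
    { subset         = record { member = λ _ → ⊤ ; respect = λ _ _ → _ }
    ; 0-closed       = _
    ; 1-closed       = _
    ; +-closed       = λ _ _ → _
    ; neg-closed     = λ _ → _
    ; *-closed       = λ _ _ → _
    ; inverse-closed = λ _ _ → _
    }

  ----------------------------------------------------------------------
  -- Vectors over 𝔽, with scalars restricted to a subfield

  𝟘 : ∀ {d} → Vector Carrier d
  𝟘 _ = 0#

  infixr 7 _·_
  _·_ : ∀ {d} → Carrier → Vector Carrier d → Vector Carrier d
  (x · v) i = x * v i

  combination : ∀ {r d} → Vector Carrier r → Vector (Vector Carrier d) r → Vector Carrier d
  combination xs vs i = sum (λ j → xs j * vs j i)

  LinearlyIndependent : ∀ {r d} → Subfield 𝔽 → Vector (Vector Carrier d) r → Set L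
  LinearlyIndependent K vs =
    ∀ xs → (∀ j → xs j ∈ₖ K) → combination xs vs ≋ 𝟘 → xs ≋ 𝟘

  Proportional : ∀ {d} → Subfield 𝔽 → Vector Carrier d → Vector Carrier d → Set L
  Proportional K u v = ∃[ x ] x ∈ₖ K × ¬ x ≈ 0# × u ≋ x · v

  module _ {d : ℕ} (K : Subfield 𝔽) where

    proportional-refl : {u : Vector Carrier d} → Proportional K u u
    proportional-refl = 1# , 1-closed K , 1≉0 , λ i → sym (*-identityˡ _)

    proportional-sym : {u v : Vector Carrier d} → Proportional K u v → Proportional K v u
    proportional-sym {u} {v} (x , x∈K , x≉0 , u≋xv) with inverse x x≉0
    ... | y , yx≈1 , xy≈1 = y , inverse-closed K x∈K xy≈1 , y≉0 , v≋yu
      where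
      open ≈-Reasoning setoid
      y≉0 : ¬ y ≈ 0#
      y≉0 y≈0 = 1≉0 (begin
        1#      ≈⟨ xy≈1 ⟨
        x * y   ≈⟨ *-congˡ y≈0 ⟩
        x * 0#  ≈⟨ zeroʳ x ⟩
        0#      ∎)
      v≋yu : v ≋ y · u
      v≋yu i = begin
        v i            ≈⟨ *-identityˡ _ ⟨
        1# * v i       ≈⟨ *-congʳ yx≈1 ⟨
        (y * x) * v i  ≈⟨ *-assoc _ _ _ ⟩
        y * (x * v i)  ≈⟨ *-congˡ (u≋xv i) ⟨
        y * u i        ∎

    proportional-trans : {u v w : Vector Carrier d} →
                         Proportional K u v → Proportional K v w → Proportional K u w
    proportional-trans {u} {v} {w} (x , x∈K , x≉0 , u≋xv) (y , y∈K , y≉0 , v≋yw) =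
      x * y , *-closed K x∈K y∈K , xy≉0 , u≋xyw
      where
      open ≈-Reasoning setoid
      xy≉0 : ¬ x * y ≈ 0#
      xy≉0 xy≈0 with inverse x x≉0
      ... | z , zx≈1 , _ = y≉0 (begin
        y            ≈⟨ *-identityˡ _ ⟨
        1# * y       ≈⟨ *-congʳ zx≈1 ⟨
        (z * x) * y  ≈⟨ *-assoc _ _ _ ⟩
        z * (x * y)  ≈⟨ *-congˡ xy≈0 ⟩
        z * 0#       ≈⟨ zeroʳ z ⟩
        0#           ∎)
      u≋xyw : u ≋ (x * y) · w
      u≋xyw i = begin
        u i            ≈⟨ u≋xv i ⟩
        x * v i        ≈⟨ *-congˡ (v≋yw i) ⟩
        x * (y * w i)  ≈⟨ *-assoc _ _ _ ⟨
        (x * y) * w i  ∎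

  ----------------------------------------------------------------------
  -- The projective space of the K-vector space 𝔽ᵈ: a point ⟨u⟩ is a
  -- nonzero vector u, taken up to a nonzero factor in K.

  module PG (K : Subfield 𝔽) (d : ℕ) where

    points : Setoid L L
    points = record
      { Carrier       = ∃[ u ] ¬ u ≋ 𝟘 {d}
      ; _≈_           = λ P Q → Proportional K (proj₁ P) (proj₁ Q)
      ; isEquivalence = record
        { refl  = proportional-refl K
        ; sym   = proportional-sym K
        ; trans = proportional-trans K
        }
      }

    open Setoid points public using () renaming (Carrier to Point)

    PointSet : Set (suc L)
    PointSet = Subset points L

    pointSets : Setoid (suc L) L
    pointSets = subsets points L

    Span : ∀ {r} → Vector (Vector Carrier d) r → Pred Point L
    Span b (u , _) = ∃[ xs ] (∀ j → xs j ∈ₖ K) × u ≋ combination xs b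

    -- A subspace of projective dimension r - 1 is spanned by r
    -- K-independent vectors.
    infix 4 _is⟨_-1⟩-dimensional
    _is⟨_-1⟩-dimensional : PointSet → ℕ → Set L
    X is⟨ r -1⟩-dimensional =
      Σ[ b ∈ Vector (Vector Carrier d) r ] LinearlyIndependent K b ×
        (∀ P → P ∈ X ⇔ Span b P)

    IsLine : PointSet → Set L
    IsLine X = X is⟨ 2 -1⟩-dimensional

    PairwiseDistinct : (A B C : PointSet) → Set L
    PairwiseDistinct A B C = ¬ A ≐ B × ¬ A ≐ C × ¬ B ≐ C

    -- Regulus of (n - 1)-spaces, for 𝔽ᵈ of dimension 2n over K.
    IsRegulus : ℕ → Subset pointSets L → Set (suc L)
    IsRegulus n R =
      (∀ X → X ∈ R → X is⟨ n -1⟩-dimensional) ×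
      (∀ l → IsLine l → ∀ A B C → A ∈ R → B ∈ R → C ∈ R → PairwiseDistinct A B C →
        Meets l A → Meets l B → Meets l C → ∀ X → X ∈ R → Meets l X)

    -- Size q + 1 has to be asked for: the line condition also holds for any
    -- part of a regulus.
    IsRegulusThrough : (q n : ℕ) (A B C : PointSet) → Subset pointSets L → Set (suc L)
    IsRegulusThrough q n A B C R =
      IsRegulus n R × HasSize (elements R) (q ℕ.+ 1) × A ∈ R × B ∈ R × C ∈ R

  ----------------------------------------------------------------------
  -- PG(2,𝔽), its line at infinity, and sublines

  PG₂ : Setoid L L
  PG₂ = PG.points whole 3

  l∞ : Subset PG₂ ℓ
  l∞ = record
    { member  = λ (u , _) → u 2F ≈ 0#
    ; respect = λ P≈Q u₂≈0 → vanish (proportional-sym whole P≈Q) u₂≈0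
    }
    where
    vanish : ∀ {u v : Vector Carrier 3} → Proportional whole u v → v 2F ≈ 0# → u 2F ≈ 0#
    vanish (x , _ , _ , u≋xv) v₂≈0 = trans (u≋xv 2F) (trans (*-congˡ v₂≈0) (zeroʳ x))

  subline : Subfield 𝔽 → (u v : Vector Carrier 3) → Subset PG₂ L
  subline K u v = record
    { member  = λ (w , _) → ∃₂ λ s t → s ∈ₖ K × t ∈ₖ K × ¬ (s ≈ 0# × t ≈ 0#) ×
                  Proportional whole w (λ i → s * u i + t * v i)
    ; respect = λ P≈Q (s , t , s∈K , t∈K , st≉0 , w∼) →
                  s , t , s∈K , t∈K , st≉0 ,
                  proportional-trans whole (proportional-sym whole P≈Q) w∼
    }

  IsSubline : Subfield 𝔽 → Subset PG₂ L → Set L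
  IsSubline K m =
    ∃₂ λ u v → LinearlyIndependent whole (u ∷ v ∷ []) × m ≐ subline K u v

  ----------------------------------------------------------------------
  -- H∞, the projective space of 𝔽² over the ground field, with its
  -- spreads. The vector (a , b) stands for (a , b , 0).

  module H∞ (ground : Subfield 𝔽) where

    open PG ground 2 public

    -- { ⟨x v⟩ : x ∈ K* }
    block : Subfield 𝔽 → Vector Carrier 2 → PointSet
    block K v = record
      { member  = λ (w , _) → ∃[ x ] x ∈ₖ K × ¬ x ≈ 0# × Proportional ground w (x · v)
      ; respect = λ P≈Q (x , x∈K , x≉0 , w∼) →
                    x , x∈K , x≉0 ,
                    proportional-trans ground (proportional-sym ground P≈Q) w∼
      }

    spread : Subfield 𝔽 → Subset pointSets L
    spread K = record
      { member  = λ X → ∃[ v ] ¬ v ≋ 𝟘 × X ≐ block K v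
      ; respect = λ (X⊆Y , Y⊆X) (v , v≉0 , X⊆B , B⊆X) →
                    v , v≉0 , (λ P → X⊆B P ∘ Y⊆X P) , (λ P → X⊆Y P ∘ B⊆X P)
      }

    𝒟 : Subset pointSets L
    𝒟 = spread whole

    φ : (P : Setoid.Carrier PG₂) → P ∈ l∞ → PointSet
    φ (u , _) _ = block whole (u 0F ∷ u 1F ∷ [])

    φ[_] : Subset PG₂ L → Subset pointSets L
    φ[ m ] = record
      { member  = λ X → ∃[ P ] P ∈ m × Σ[ P∈l∞ ∈ P ∈ l∞ ] X ≐ φ P P∈l∞
      ; respect = λ (X⊆Y , Y⊆X) (P , P∈m , P∈l∞ , X⊆B , B⊆X) → P , P∈m , P∈l∞ ,
                    (λ Q → X⊆B Q ∘ Y⊆X Q) , (λ Q → X⊆Y Q ∘ B⊆X Q)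
      }

-- Three distinct elements of 𝒟 can be written ⟨u⟩, ⟨v⟩, ⟨u + v⟩ over 𝔽_{q^n},
-- and the regulus through them is then { ⟨s u + t v⟩ : (s , t) in PG(1,q) }: a
-- space meeting all the transversals ⟨a u , a v⟩ must meet them in one and the
-- same direction (s , t). In such coordinates S is ⟨v⟩ together with ⟨u + t v⟩
-- for t in a set T of size q^k containing 0 and 1, and S is the image of a
-- subline over 𝔽_{q^k} as soon as T is closed under multiplication, because then
-- T = { x : x^(q^k) = x } = 𝔽_{q^k}.
--
-- If S contains the reguli of its triples, T is closed under 𝔽q-affine
-- combinations of two elements, hence additive as q > 2. The same holds with u
-- and v exchanged, which replaces T by the inverses of its elements, and Hua's
-- identity makes T multiplicatively closed.
--
-- If W is a (2k-1)-space meeting each element of S in a (k-1)-space, counting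
-- gives W = X u + X v for one 𝔽q-space X of size q^k, and t X ⊆ X for all t in
-- T. For nonzero x in X counting gives X = x T, so T is multiplicatively closed.

module Submission where

open import Defs
open import Algebra.Bundles using (CommutativeRing)
import Algebra.Properties.CommutativeMonoid.Sum as CommutativeMonoidSum
import Algebra.Properties.Monoid.Mult.TCOptimised
import Algebra.Properties.Ring
import Algebra.Properties.Semiring.Exp
import Algebra.Properties.Semiring.Mult.TCOptimised
import Algebra.Properties.Semiring.Sum
import Algebra.Solver.Ring
open import Algebra.Solver.Ring.AlmostCommutativeRing
  using (fromCommutativeRing; _-Raw-AlmostCommutative⟶_; Induced-equivalence)
open import Data.Fin.Base using (Fin; zero; suc; punchIn; punchOut; combine; remQuot; finToFun; funToFin)
open import Data.Fin.Patterns using (0F; 1F; 2F)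
import Data.Fin.Permutation as Permutation
import Data.Fin.Properties as Fin
open import Data.Fin.Properties
  using (any?; injective⇒≤; punchIn-injective; punchInᵢ≢i; punchIn-punchOut; funToFin-finToFin; finToFun-funToFin)
open import Data.Integer.Base as ℤ using (ℤ; +_; -[1+_]; +[1+_])
import Data.Integer.Properties as ℤ
open import Data.Maybe.Base using (just; nothing)
open import Data.Nat.Base as ℕ using (ℕ; zero; suc; s≤s)
open import Data.Nat.Divisibility using (_∣_; 0∣⇒≡0)
import Data.Nat.Properties as ℕ
open import Data.Product using (∃!)
open import Data.Product.Base using (Σ-syntax; ∃; ∃-syntax; ∃₂; _×_; _,_; proj₁; proj₂)
open import Data.Product.Relation.Binary.Pointwise.NonDependent using (×-setoid)
open import Data.Sign.Base as Sign using (Sign)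
open import Data.Sum.Base using (_⊎_; inj₁; inj₂)
open import Data.Vec.Functional using (Vector; []; _∷_)
import Data.Vec.Functional.Relation.Binary.Equality.Setoid as VectorEquality
open import Function.Base using (_∘_; case_of_)
open import Function.Bundles using (Bijection; _⇔_; mk⇔; Equivalence)
open import Level using (Level; _⊔_)
open import Relation.Binary.Bundles using (Setoid)
open import Relation.Binary.Definitions using (Decidable; WeaklyDecidable)
open import Relation.Binary.PropositionalEquality.Core as ≡ using (_≡_; _≢_)
import Relation.Binary.Reasoning.Setoid as ≈-Reasoning
open import Relation.Nullary.Decidable using (Dec; yes; no; map′; ¬?; decidable-stable; _×-dec_)
open import Relation.Nullary.Negation using (¬_; contradiction)

-- The two subfields are known only through their sizes, so 𝔽qᵏ has to be recognised by counting: N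
-- elements closed under multiplication satisfy x^N = x, because multiplication by a nonzero one
-- permutes the nonzero ones, and a monic polynomial of degree N has at most N roots. Dimensions are
-- treated likewise: an (r - 1)-space is traded for a linear subspace of q^r vectors, and the
-- decisive set equalities come from injections between finite sets of equal size. The second
-- condition asserts both existence and uniqueness of the regulus, so both are established: the
-- 𝔽q-subline gives existence, and the common direction gives uniqueness. The obstacle before Hua's
-- identity is that inversion takes T to the set T′ of the exchanged coordinates; an expression for
-- z⁻¹ that inverts once from T to T′ and once back closes T itself under inverses. All implications
-- pass through one statement in coordinates, `IsSublineImage`.

-- Finite setoids and subsets: pigeonhole and counting.

module Finite where

  private variable
    a b ℓ ℓ′ p r : Level
    M N : ℕ
    A : Setoid a ℓ
    B : Setoid b ℓ′

  module _ {A : Setoid a ℓ} (|A| : HasSize A N) where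

    open Setoid A

    abstract
      enum : Fin N → Carrier
      enum = Bijection.to |A|

      enum-injective : ∀ {i j} → enum i ≈ enum j → i ≡ j
      enum-injective = Bijection.injective |A|

      index : Carrier → Fin N
      index = Bijection.to⁻ |A|

      enum-index : ∀ x → enum (index x) ≈ x
      enum-index x = proj₂ (Bijection.strictlySurjective |A| x)

      index-injective : ∀ {x y} → index x ≡ index y → x ≈ y
      index-injective {x} {y} i≡j =
        trans (sym (enum-index x)) (trans (reflexive (≡.cong enum i≡j)) (enum-index y))

      index-cong : ∀ {x y} → x ≈ y → index x ≡ index y
      index-cong x≈y = enum-injective (trans (enum-index _) (trans x≈y (sym (enum-index _))))

      finite⇒dec : Decidable _≈_
      finite⇒dec x y = map′ index-injective index-cong (index x Fin.≟ index y)

  module _ {A : Setoid a ℓ} where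

    open Setoid A

    abstract
      fromEnumeration : (e : Fin N → Carrier) → (∀ {i j} → e i ≈ e j → i ≡ j) →
                        (∀ x → ∃[ i ] e i ≈ x) → HasSize A N
      fromEnumeration e e-inj e-surj = record
        { to        = e
        ; cong      = λ { ≡.refl → refl }
        ; bijective = e-inj , λ x → proj₁ (e-surj x) , λ { ≡.refl → proj₂ (e-surj x) }
        }

  abstract
    -- If j were missed, punching it out would inject `Fin (suc N′)` into `Fin N′`.
    injective⇒surjective-Fin : (f : Fin N → Fin N) → (∀ {i j} → f i ≡ f j → i ≡ j) →
                               ∀ j → ∃[ i ] f i ≡ j
    injective⇒surjective-Fin {N} f f-inj j with any? (λ i → f i Fin.≟ j)
    ... | yes hit = hit
    ... | no miss with N
    ...   | suc N′ = contradiction (injective⇒≤ {f = g} g-inj) ℕ.1+n≰n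
      where
      g : Fin (suc N′) → Fin N′
      g i = punchOut {i = j} (λ j≡fi → miss (i , ≡.sym j≡fi))
      g-inj : ∀ {i k} → g i ≡ g k → i ≡ k
      g-inj {i} {k} gi≡gk = f-inj (Fin.punchOut-injective {i = j} _ _ gi≡gk)

  module _ {A : Setoid a ℓ} {B : Setoid b ℓ′} (f : Setoid.Carrier A → Setoid.Carrier B)
           (f-inj : ∀ {x y} → Setoid._≈_ B (f x) (f y) → Setoid._≈_ A x y) where

    private
      module A = Setoid A
      module B = Setoid B

    abstract
      injective⇒size-≤ : HasSize A M → HasSize B N → M ℕ.≤ N
      injective⇒size-≤ |A| |B| = injective⇒≤ {f = index |B| ∘ f ∘ enum |A|}
        (enum-injective |A| ∘ f-inj ∘ index-injective |B|)

      -- No congruence of f is needed: a choice of f on representatives suffices.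
      injective⇒surjective : HasSize A N → HasSize B N → ∀ y → ∃[ x ] f x B.≈ y
      injective⇒surjective |A| |B| y
        with injective⇒surjective-Fin (index |B| ∘ f ∘ enum |A|)
               (enum-injective |A| ∘ f-inj ∘ index-injective |B|) (index |B| y)
      ... | i , eq = enum |A| i , index-injective |B| eq

      transport-size : (∀ {x y} → x A.≈ y → f x B.≈ f y) → (∀ y → ∃[ x ] f x B.≈ y) →
                       HasSize A N → HasSize B N
      transport-size f-cong f-surj |A| = fromEnumeration {A = B} (f ∘ enum |A|)
        (enum-injective |A| ∘ f-inj)
        (λ y → let x , fx≈y = f-surj y in
               index |A| x , B.trans (f-cong (enum-index |A| x)) fx≈y)

      transport-size⁻ : (∀ {x y} → x A.≈ y → f x B.≈ f y) → (∀ y → ∃[ x ] f x B.≈ y) →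
                        HasSize B N → HasSize A N
      transport-size⁻ f-cong f-surj |B| = fromEnumeration {A = A} (proj₁ ∘ f-surj ∘ enum |B|)
        (λ {i} {j} eq → enum-injective |B| (B.trans (B.sym (proj₂ (f-surj (enum |B| i))))
          (B.trans (f-cong eq) (proj₂ (f-surj (enum |B| j))))))
        (λ x → index |B| (f x) , f-inj (B.trans (proj₂ (f-surj _)) (enum-index |B| (f x))))

  abstract
    ×-size : HasSize A M → HasSize B N → HasSize (×-setoid A B) (M ℕ.* N)
    ×-size {A = A} {M = M} {B = B} {N = N} |A| |B| = fromEnumeration {A = ×-setoid A B}
      (pair ∘ remQuot N)
      (λ {i} {j} (eq₁ , eq₂) → ≡.trans (≡.sym (Fin.combine-remQuot {M} N i))
        (≡.trans (≡.cong₂ combine (enum-injective |A| eq₁) (enum-injective |B| eq₂))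
          (Fin.combine-remQuot {M} N j)))
      (λ (x , y) → combine (index |A| x) (index |B| y) ,
        ≡.subst (λ ij → Setoid._≈_ (×-setoid A B) (pair ij) (x , y))
          (≡.sym (Fin.remQuot-combine (index |A| x) (index |B| y)))
          (enum-index |A| x , enum-index |B| y))
      where
      pair : Fin M × Fin N → Setoid.Carrier (×-setoid A B)
      pair (i , j) = enum |A| i , enum |B| j

    vector-size : HasSize A N → ∀ r → HasSize (VectorEquality.≋-setoid A r) (N ℕ.^ r)
    vector-size {A = A} {N = N} |A| r = fromEnumeration {A = VectorEquality.≋-setoid A r}
      (λ i j → enum |A| (finToFun i j))
      (λ {i} {j} eq → ≡.trans (≡.sym (funToFin-finToFin {r} {N} i))
        (≡.trans (funToFin-cong r (λ l → enum-injective |A| (eq l))) (funToFin-finToFin {r} {N} j)))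
      (λ v → funToFin (index |A| ∘ v) , λ j → trans
        (reflexive (≡.cong (enum |A|) (finToFun-funToFin (index |A| ∘ v) j))) (enum-index |A| (v j)))
      where
      open Setoid A
      funToFin-cong : ∀ r {f g : Fin r → Fin N} → (∀ j → f j ≡ g j) → funToFin f ≡ funToFin g
      funToFin-cong zero    f≗g = ≡.refl
      funToFin-cong (suc r) f≗g = ≡.cong₂ combine (f≗g zero) (funToFin-cong r (f≗g ∘ suc))

  module _ {A : Setoid a ℓ} where

    open Setoid A

    module _ {X : Subset A p} (|X| : HasSize (elements X) N) where

      abstract
        member? : Decidable _≈_ → ∀ x → Dec (x ∈ X)
        member? _≟_ x = map′
          (λ (i , eᵢ≈x) → respect X eᵢ≈x (proj₂ (enum |X| i)))
          (λ x∈X → index |X| (x , x∈X) , enum-index |X| (x , x∈X))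
          (any? (λ i → proj₁ (enum |X| i) ≟ x))

        -- The inclusion is an injection between sets of equal size, hence onto. This turns one
        -- proved inclusion into an equality of sets.
        ⊆-size⇒⊇ : {Y : Subset A r} → HasSize (elements Y) N → X ⊆ Y → Y ⊆ X
        ⊆-size⇒⊇ {Y = Y} |Y| X⊆Y y y∈Y
          with injective⇒surjective {A = elements X} {B = elements Y}
                 (λ (x , x∈X) → x , X⊆Y x x∈X) (λ eq → eq) |X| |Y| (y , y∈Y)
        ... | (x , x∈X) , x≈y = respect X x≈y x∈X

    infixl 6 _∖_
    _∖_ : Subset A p → Carrier → Subset A (p ⊔ ℓ)
    X ∖ a = record
      { member  = λ x → x ∈ X × ¬ x ≈ a
      ; respect = λ x≈y (x∈X , x≉a) → respect X x≈y x∈X , λ y≈a → x≉a (trans x≈y y≈a)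
      }

    abstract
      ∖-size : {X : Subset A p} {x : Carrier} → x ∈ X → HasSize (elements X) (suc N) →
               HasSize (elements (X ∖ x)) N
      ∖-size {N = N} {X = X} {x} x∈X |X| = fromEnumeration {A = elements (X ∖ x)} e
        (λ {i} {j} → punchIn-injective i₀ i j ∘ enum-injective |X|) e-surj
        where
        i₀ : Fin (suc N)
        i₀ = index |X| (x , x∈X)
        e : Fin N → ∃ (member (X ∖ x))
        e j = let y , y∈X = enum |X| (punchIn i₀ j) in y , y∈X , λ y≈x → punchInᵢ≢i i₀ j
          (enum-injective |X| (trans y≈x (sym (enum-index |X| (x , x∈X)))))
        e-surj : ∀ ((y , _) : ∃ (member (X ∖ x))) → ∃[ j ] proj₁ (e j) ≈ y
        e-surj (y , y∈X , y≉x) = punchOut i₀≢j , trans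
          (reflexive (≡.cong (proj₁ ∘ enum |X|) (punchIn-punchOut i₀≢j))) (enum-index |X| (y , y∈X))
          where
          i₀≢j : i₀ ≢ index |X| (y , y∈X)
          i₀≢j i₀≡j = y≉x (sym (index-injective |X| i₀≡j))

      -- If every enumerated element of V lay in U, then V would inject into the smaller U. It
      -- supplies the next vector when a basis is built.
      escape : Decidable _≈_ → {U : Subset A p} {V : Subset A r} → HasSize (elements U) M →
               HasSize (elements V) N → M ℕ.< N → ∃[ w ] w ∈ V × ¬ w ∈ U
      escape _≟_ {U} {V} |U| |V| M<N
        with any? (λ i → ¬? (member? {X = U} |U| _≟_ (proj₁ (enum |V| i))))
      ... | yes (i , wᵢ∉U) = proj₁ (enum |V| i) , proj₂ (enum |V| i) , wᵢ∉U
      ... | no  none = contradiction M<N (ℕ.≤⇒≯ (injective⇒size-≤ {A = elements V} {B = elements U}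
              (λ (w , w∈V) → w , V⊆U w w∈V) (λ eq → eq) |V| |U|))
        where
        V⊆U : V ⊆ U
        V⊆U w w∈V = respect U (enum-index |V| (w , w∈V))
          (decidable-stable (member? {X = U} |U| _≟_ _) (λ ∉U → none (index |V| (w , w∈V) , ∉U)))

-- Polynomial identities in a commutative ring, with integer coefficients.

module IntegerCoefficients {c ℓ} (R : CommutativeRing c ℓ) where

  open CommutativeRing R
  open Algebra.Properties.Ring ring using (-0#≈0#; -‿distribˡ-*; -‿distribʳ-*; -‿+-comm; -‿involutive)
  open Algebra.Properties.Semiring.Mult.TCOptimised semiring using (×1-homo-*)
  open Algebra.Properties.Monoid.Mult.TCOptimised +-monoid using ()
    renaming (_×_ to _⨯_; ×-homo-+ to ⨯-homo-+; 1+× to 1+⨯)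
  open ≈-Reasoning setoid

  -- The canonical homomorphism from ℤ. Coefficients with computable equality let the solver cancel
  -- terms such as x - x.
  ⟦_⟧ : ℤ → Carrier
  ⟦ + n ⟧      = n ⨯ 1#
  ⟦ -[1+ n ] ⟧ = - (suc n ⨯ 1#)

  private
    cancel-1 : ∀ x y → (1# + x) - (1# + y) ≈ x - y
    cancel-1 x y = begin
      (1# + x) + - (1# + y)      ≈⟨ +-cong (+-comm _ _) (sym (-‿+-comm _ _)) ⟩
      (x + 1#) + (- 1# + - y)    ≈⟨ +-assoc _ _ _ ⟩
      x + (1# + (- 1# + - y))    ≈⟨ +-congˡ (+-assoc _ _ _) ⟨
      x + ((1# + - 1#) + - y)    ≈⟨ +-congˡ (+-congʳ (-‿inverseʳ _)) ⟩
      x + (0# + - y)             ≈⟨ +-congˡ (+-identityˡ _) ⟩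
      x - y                      ∎

    ⊖-homo : ∀ m n → ⟦ m ℤ.⊖ n ⟧ ≈ m ⨯ 1# - n ⨯ 1#
    ⊖-homo m       zero    = sym (trans (+-congˡ -0#≈0#) (+-identityʳ _))
    ⊖-homo zero    (suc n) = sym (+-identityˡ _)
    ⊖-homo (suc m) (suc n) = begin
      ⟦ suc m ℤ.⊖ suc n ⟧              ≈⟨ reflexive (≡.cong ⟦_⟧ (ℤ.[1+m]⊖[1+n]≡m⊖n m n)) ⟩
      ⟦ m ℤ.⊖ n ⟧                      ≈⟨ ⊖-homo m n ⟩
      m ⨯ 1# - n ⨯ 1#                  ≈⟨ cancel-1 _ _ ⟨
      (1# + m ⨯ 1#) - (1# + n ⨯ 1#)    ≈⟨ +-cong (1+⨯ m 1#) (-‿cong (1+⨯ n 1#)) ⟨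
      suc m ⨯ 1# - suc n ⨯ 1#          ∎

    +-homo : ∀ i j → ⟦ i ℤ.+ j ⟧ ≈ ⟦ i ⟧ + ⟦ j ⟧
    +-homo (+ m)      (+ n)      = ⨯-homo-+ 1# m n
    +-homo (+ m)      -[1+ n ]   = ⊖-homo m (suc n)
    +-homo -[1+ m ]   (+ n)      = trans (⊖-homo n (suc m)) (+-comm _ _)
    +-homo -[1+ m ]   -[1+ n ]   = begin
      - (suc (suc (m ℕ.+ n)) ⨯ 1#)        ≈⟨ -‿cong (reflexive (≡.cong (λ k → suc k ⨯ 1#) (ℕ.+-suc m n))) ⟨
      - ((suc m ℕ.+ suc n) ⨯ 1#)          ≈⟨ -‿cong (⨯-homo-+ 1# (suc m) (suc n)) ⟩
      - (suc m ⨯ 1# + suc n ⨯ 1#)         ≈⟨ -‿+-comm _ _ ⟨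
      - (suc m ⨯ 1#) + - (suc n ⨯ 1#)     ∎

    -‿homo : ∀ i → ⟦ ℤ.- i ⟧ ≈ - ⟦ i ⟧
    -‿homo (+ zero)    = sym -0#≈0#
    -‿homo +[1+ n ]    = refl
    -‿homo -[1+ n ]    = sym (-‿involutive _)

    +◃-homo : ∀ n → ⟦ Sign.+ ℤ.◃ n ⟧ ≈ n ⨯ 1#
    +◃-homo zero    = refl
    +◃-homo (suc n) = refl

    -◃-homo : ∀ n → ⟦ Sign.- ℤ.◃ n ⟧ ≈ - (n ⨯ 1#)
    -◃-homo zero    = sym -0#≈0#
    -◃-homo (suc n) = refl

    *-homo : ∀ i j → ⟦ i ℤ.* j ⟧ ≈ ⟦ i ⟧ * ⟦ j ⟧
    *-homo (+ m)    (+ n)    = trans (+◃-homo (m ℕ.* n)) (×1-homo-* m n)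
    *-homo (+ m)    -[1+ n ] = begin
      ⟦ Sign.- ℤ.◃ (m ℕ.* suc n) ⟧   ≈⟨ -◃-homo (m ℕ.* suc n) ⟩
      - ((m ℕ.* suc n) ⨯ 1#)         ≈⟨ -‿cong (×1-homo-* m (suc n)) ⟩
      - (m ⨯ 1# * (suc n ⨯ 1#))      ≈⟨ -‿distribʳ-* _ _ ⟩
      m ⨯ 1# * - (suc n ⨯ 1#)        ∎
    *-homo -[1+ m ] (+ n)    = begin
      ⟦ Sign.- ℤ.◃ (suc m ℕ.* n) ⟧   ≈⟨ -◃-homo (suc m ℕ.* n) ⟩
      - ((suc m ℕ.* n) ⨯ 1#)         ≈⟨ -‿cong (×1-homo-* (suc m) n) ⟩
      - (suc m ⨯ 1# * (n ⨯ 1#))      ≈⟨ -‿distribˡ-* _ _ ⟩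
      - (suc m ⨯ 1#) * (n ⨯ 1#)      ∎
    *-homo -[1+ m ] -[1+ n ] = begin
      (suc m ℕ.* suc n) ⨯ 1#               ≈⟨ ×1-homo-* (suc m) (suc n) ⟩
      suc m ⨯ 1# * (suc n ⨯ 1#)            ≈⟨ -‿involutive _ ⟨
      - - (suc m ⨯ 1# * (suc n ⨯ 1#))      ≈⟨ -‿cong (-‿distribʳ-* _ _) ⟩
      - (suc m ⨯ 1# * - (suc n ⨯ 1#))      ≈⟨ -‿distribˡ-* _ _ ⟩
      - (suc m ⨯ 1#) * - (suc n ⨯ 1#)      ∎

    morphism : ℤ.+-*-rawRing -Raw-AlmostCommutative⟶ fromCommutativeRing R
    morphism = record
      { ⟦_⟧    = ⟦_⟧
      ; +-homo = +-homo
      ; *-homo = *-homo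
      ; -‿homo = -‿homo
      ; 0-homo = refl
      ; 1-homo = refl
      }

    -- Distinct integers may still agree in R when the characteristic is positive, so inequality
    -- yields no verdict.
    ≟-coefficient : WeaklyDecidable (Induced-equivalence morphism)
    ≟-coefficient i j with i ℤ.≟ j
    ... | yes ≡.refl = just (refl {⟦ i ⟧})
    ... | no _       = nothing

  open Algebra.Solver.Ring ℤ.+-*-rawRing (fromCommutativeRing R) morphism ≟-coefficient public
    using (solve; _:=_; _:+_; _:*_; _:-_; :-_; con)

  :0 :1 : ∀ {n} → Algebra.Solver.Ring.Polynomial ℤ.+-*-rawRing (fromCommutativeRing R) morphism ≟-coefficient n
  :0 = con (+ 0)
  :1 = con (+ 1)

open Finite

-- Fields: equations with certificates, powers, and roots of polynomials.

module FieldProperties {c ℓ} (𝔽 : Field c ℓ) (_≟_ : Decidable (Field._≈_ 𝔽)) where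

  open Field 𝔽 hiding (zero)
  open IntegerCoefficients commutativeRing public using (solve; _:=_; _:+_; _:*_; _:-_; :-_; :0; :1)
  open Algebra.Properties.Semiring.Exp semiring using (_^_; ^-congˡ)
  open CommutativeMonoidSum *-commutativeMonoid using ()
    renaming (sum to product; sum-cong-≋ to product-cong; sum-permute to product-permute)
  open ≈-Reasoning setoid

  infix 4 _≉0
  _≉0 : Carrier → Set ℓ
  x ≉0 = ¬ x ≈ 0#

  infix 9 _⁻¹
  -- 0# ⁻¹ = 0#
  _⁻¹ : Carrier → Carrier
  x ⁻¹ with x ≟ 0#
  ... | yes _  = 0#
  ... | no x≉0 = proj₁ (inverse x x≉0)

  x*x⁻¹≈1 : ∀ {x} → x ≉0 → x * x ⁻¹ ≈ 1#
  x*x⁻¹≈1 {x} x≉0 with x ≟ 0#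
  ... | yes x≈0 = contradiction x≈0 x≉0
  ... | no x≉0′ = proj₂ (proj₂ (inverse x x≉0′))

  x-y≈0⇒x≈y : ∀ {x y} → x - y ≈ 0# → x ≈ y
  x-y≈0⇒x≈y {x} {y} x-y≈0 = begin
    x            ≈⟨ solve 2 (λ x y → x := (x :- y) :+ y) refl x y ⟩
    (x - y) + y  ≈⟨ +-congʳ x-y≈0 ⟩
    0# + y       ≈⟨ +-identityˡ y ⟩
    y            ∎

  x≈y⇒x-y≈0 : ∀ {x y} → x ≈ y → x - y ≈ 0#
  x≈y⇒x-y≈0 x≈y = trans (+-congʳ x≈y) (-‿inverseʳ _)

  -- A certificate of ideal membership: s is the cofactor that writes x - y as a multiple of a - b.
  -- It brings known equations, such as x x⁻¹ = 1, within reach of the ring solver.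
  modulo : ∀ {a b} s {x y} → a ≈ b → x - y ≈ s * (a - b) → x ≈ y
  modulo s a≈b eq = x-y≈0⇒x≈y (trans eq (trans (*-congˡ (x≈y⇒x-y≈0 a≈b)) (zeroʳ s)))

  modulo₂ : ∀ {a b a′ b′} s s′ {x y} → a ≈ b → a′ ≈ b′ →
            x - y ≈ s * (a - b) + s′ * (a′ - b′) → x ≈ y
  modulo₂ s s′ a≈b a′≈b′ eq = x-y≈0⇒x≈y (trans eq (trans
    (+-cong (trans (*-congˡ (x≈y⇒x-y≈0 a≈b)) (zeroʳ s)) (trans (*-congˡ (x≈y⇒x-y≈0 a′≈b′)) (zeroʳ s′)))
    (+-identityˡ 0#)))

  xy≈0⇒y≈0 : ∀ {x y} → x ≉0 → x * y ≈ 0# → y ≈ 0#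
  xy≈0⇒y≈0 {x} {y} x≉0 xy≈0 = modulo₂ (- y) (x ⁻¹) (x*x⁻¹≈1 x≉0) xy≈0
    (solve 3 (λ x y i → y :- :0 := (:- y) :* (x :* i :- :1) :+ i :* (x :* y :- :0)) refl x y (x ⁻¹))

  *-≉0 : ∀ {x y} → x ≉0 → y ≉0 → x * y ≉0
  *-≉0 x≉0 y≉0 xy≈0 = y≉0 (xy≈0⇒y≈0 x≉0 xy≈0)

  ≉0ˡ : ∀ {x y} → x * y ≉0 → x ≉0
  ≉0ˡ xy≉0 x≈0 = xy≉0 (trans (*-congʳ x≈0) (zeroˡ _))

  ≉0ʳ : ∀ {x y} → x * y ≉0 → y ≉0
  ≉0ʳ xy≉0 y≈0 = xy≉0 (trans (*-congˡ y≈0) (zeroʳ _))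

  ≉0-resp : ∀ {x y} → x ≈ y → x ≉0 → y ≉0
  ≉0-resp x≈y x≉0 y≈0 = x≉0 (trans x≈y y≈0)

  ⁻¹-≉0 : ∀ {x} → x ≉0 → x ⁻¹ ≉0
  ⁻¹-≉0 x≉0 = ≉0ʳ (≉0-resp (sym (x*x⁻¹≈1 x≉0)) 1≉0)

  *-cancelˡ-≉0 : ∀ {x y z} → x ≉0 → x * y ≈ x * z → y ≈ z
  *-cancelˡ-≉0 {x} {y} {z} x≉0 eq = x-y≈0⇒x≈y (xy≈0⇒y≈0 x≉0
    (trans (solve 3 (λ x y z → x :* (y :- z) := x :* y :- x :* z) refl x y z) (x≈y⇒x-y≈0 eq)))

  product-≉0 : ∀ n (f : Fin n → Carrier) → (∀ i → f i ≉0) → product f ≉0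
  product-≉0 zero    f f≉0 = 1≉0
  product-≉0 (suc n) f f≉0 = *-≉0 (f≉0 zero) (product-≉0 n (f ∘ suc) (f≉0 ∘ suc))

  product-scale : ∀ n x (f : Fin n → Carrier) → product (λ i → x * f i) ≈ x ^ n * product f
  product-scale zero    x f = sym (*-identityˡ 1#)
  product-scale (suc n) x f = trans (*-congˡ (product-scale n x (f ∘ suc)))
    (solve 4 (λ x y u v → (x :* y) :* (u :* v) := (x :* u) :* (y :* v)) refl
      x (f zero) (x ^ n) (product (f ∘ suc)))

  module _ {p} {T : Subset setoid p} (0∈T : 0# ∈ T)
           (*-closed : ∀ {x y} → x ∈ T → y ∈ T → x * y ∈ T) where

    -- Multiplication by x ≉ 0 permutes the nonzero elements of T.
    fermat : ∀ {N} → HasSize (elements T) N → ∀ {x} → x ∈ T → x ^ N ≈ x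
    fermat {zero}  |T| x∈T with () ← index |T| (0# , 0∈T)
    fermat {suc N} |T| {x} x∈T with x ≟ 0#
    ... | yes x≈0 = trans (*-congʳ x≈0) (trans (zeroˡ _) (sym x≈0))
    ... | no x≉0 = trans (*-congˡ xᴺ≈1) (*-identityʳ x)
      where
      T* : Subset setoid _
      T* = T ∖ 0#
      |T*| : HasSize (elements T*) N
      |T*| = ∖-size {X = T} 0∈T |T|
      e : Fin N → Carrier
      e = proj₁ ∘ enum |T*|
      shift : ∃ (member T*) → ∃ (member T*)
      shift (y , y∈T , y≉0) = x * y , *-closed x∈T y∈T , *-≉0 x≉0 y≉0
      shift-surjective : ∀ y → ∃[ z ] proj₁ (shift z) ≈ proj₁ y
      shift-surjective = injective⇒surjective {A = elements T*} {B = elements T*}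
        shift (*-cancelˡ-≉0 x≉0) |T*| |T*|
      σ τ : Fin N → Fin N
      σ i = index |T*| (shift (enum |T*| i))
      τ j = index |T*| (proj₁ (shift-surjective (enum |T*| j)))
      eσ : ∀ i → e (σ i) ≈ x * e i
      eσ i = enum-index |T*| (shift (enum |T*| i))
      eτ : ∀ j → x * e (τ j) ≈ e j
      eτ j = trans (*-congˡ (enum-index |T*| (proj₁ (shift-surjective (enum |T*| j)))))
        (proj₂ (shift-surjective (enum |T*| j)))
      π : Permutation.Permutation N N
      π = Permutation.permutation σ τ
        (λ j → enum-injective |T*| (trans (eσ (τ j)) (eτ j)))
        (λ i → enum-injective |T*| (*-cancelˡ-≉0 x≉0 (trans (eτ (σ i)) (eσ i))))
      xᴺ≈1 : x ^ N ≈ 1#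
      xᴺ≈1 = *-cancelˡ-≉0 (product-≉0 N e (λ i → proj₂ (proj₂ (enum |T*| i)))) (begin
        product e * x ^ N          ≈⟨ *-comm _ _ ⟩
        x ^ N * product e          ≈⟨ product-scale N x e ⟨
        product (λ i → x * e i)    ≈⟨ product-cong eσ ⟨
        product (e ∘ σ)            ≈⟨ product-permute e π ⟨
        product e                  ≈⟨ *-identityʳ _ ⟨
        product e * 1#             ∎)

  -- Monic polynomial functions of degree d, presented by division: f - f(a)
  -- is divisible by x - a for every a, with a monic quotient.
  Monic : ℕ → (Carrier → Carrier) → Set (c ⊔ ℓ)
  Monic zero    f = ∀ x → f x ≈ 1#
  Monic (suc d) f = ∀ a → ∃[ g ] Monic d g × ∀ x → f x ≈ f a + (x - a) * g x

  -- The quotients by x - a add up in the same way, so the claim descends to degree 0, where g is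
  -- constant and changes only the value at a.
  monic-+ : ∀ d {f g} b → Monic (suc d) f → Monic d g → Monic (suc d) (λ x → f x + b * g x)
  monic-+ zero {f} {g} b F G a with F a
  ... | h , H , f≈ = h , H , λ x → begin
    f x + b * g x                          ≈⟨ +-cong (f≈ x) (*-congˡ (trans (G x) (sym (G a)))) ⟩
    (f a + (x - a) * h x) + b * g a        ≈⟨ solve 3 (λ u v w → (u :+ v) :+ w := (u :+ w) :+ v) refl (f a) _ _ ⟩
    (f a + b * g a) + (x - a) * h x        ∎
  monic-+ (suc d) {f} {g} b F G a with F a | G a
  ... | h , H , f≈ | k , K , g≈ = (λ x → h x + b * k x) , monic-+ d b H K , λ x → begin
    f x + b * g x
      ≈⟨ +-cong (f≈ x) (*-congˡ (g≈ x)) ⟩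
    (f a + (x - a) * h x) + b * (g a + (x - a) * k x)
      ≈⟨ solve 6 (λ u v w y z b → (u :+ v :* w) :+ b :* (y :+ v :* z) := (u :+ b :* y) :+ v :* (w :+ b :* z))
           refl (f a) (x - a) (h x) (g a) (k x) b ⟩
    (f a + b * g a) + (x - a) * (h x + b * k x)  ∎

  monic-^ : ∀ d → Monic d (_^ d)
  monic-^ zero    x = refl
  monic-^ (suc zero) a = (λ _ → 1#) , (λ _ → refl) ,
    λ x → solve 2 (λ x a → x :* :1 := a :* :1 :+ (x :- a) :* :1) refl x a
  monic-^ (suc (suc d)) = step (monic-^ (suc d))
    where
    step : Monic (suc d) (_^ suc d) → Monic (suc (suc d)) (_^ suc (suc d))
    step F a with F a
    -- x f(x) - a f(a) = (x - a) f(x) + a (f(x) - f(a)), so the quotient is f + a g.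
    ... | g , G , eq = _ , monic-+ d a F G , λ x → modulo a (eq x)
      (solve 5 (λ x a u v w → x :* u :- (a :* v :+ (x :- a) :* (u :+ a :* w))
         := a :* (u :- (v :+ (x :- a) :* w))) refl x a (x ^ suc d) (a ^ suc d) (g x))

  monic-shift : ∀ d {f} b → Monic (suc d) f → Monic (suc d) (λ x → f x + b)
  monic-shift d {f} b F a with F a
  ... | h , H , f≈ = h , H , λ x → modulo 1# (f≈ x)
    (solve 4 (λ u v w b → (u :+ b) :- ((v :+ b) :+ w) := :1 :* (u :- (v :+ w))) refl (f x) (f a) _ b)

  -- In degree at least two the term b x stays below the leading one. With b = -1 this makes x^N - x
  -- monic.
  monic-linear : ∀ d {f} b → Monic (suc (suc d)) f → Monic (suc (suc d)) (λ x → f x + b * x)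
  monic-linear d {f} b F a with F a
  ... | h , H , f≈ = (λ x → h x + b) , monic-shift d b H , λ x → modulo 1# (f≈ x)
    (solve 6 (λ u v w b x a → (u :+ b :* x) :- ((v :+ b :* a) :+ (x :- a) :* (w :+ b))
       := :1 :* (u :- (v :+ (x :- a) :* w))) refl (f x) (f a) (h x) b x a)

  -- Divide by x - r for the first root r: the remaining roots differ from r, so they are roots of
  -- the quotient, whose degree is one lower.
  roots≤degree : ∀ d {f} → Monic d f → (r : Fin (suc d) → Carrier) →
                 (∀ {i j} → r i ≈ r j → i ≡ j) → ¬ (∀ i → f (r i) ≈ 0#)
  roots≤degree zero    F r r-inj fr≈0 = 1≉0 (trans (sym (F (r zero))) (fr≈0 zero))
  roots≤degree (suc d) {f} F r r-inj fr≈0 with F (r zero)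
  ... | g , G , f≈ = roots≤degree d G (r ∘ suc) (λ eq → suc-inj (r-inj eq)) λ i →
    xy≈0⇒y≈0 (λ eq → 0≢suc (r-inj (sym (x-y≈0⇒x≈y eq))))
      (trans (modulo₂ (- 1#) (- 1#) (f≈ (r (suc i))) (fr≈0 zero)
        (solve 3 (λ u v w → w :- u := (:- :1) :* (u :- (v :+ w)) :+ (:- :1) :* (v :- :0)) refl
          (f (r (suc i))) (f (r zero)) _)) (fr≈0 (suc i)))
    where
    suc-inj : ∀ {n} {i j : Fin n} → Fin.suc i ≡ suc j → i ≡ j
    suc-inj ≡.refl = ≡.refl
    0≢suc : ∀ {n} {i : Fin n} → Fin.zero ≢ suc i
    0≢suc ()

  module _ {p} {T : Subset setoid p} (0∈T : 0# ∈ T)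
           (*-closed : ∀ {x y} → x ∈ T → y ∈ T → x * y ∈ T) where

    -- By `fermat` the N elements of T are roots of x^N - x; an x outside T would be root number N +
    -- 1.
    x^N≈x⇒x∈T : ∀ {N} → HasSize (elements T) N → N ℕ.≥ 2 → ∀ {x} → x ^ N ≈ x → x ∈ T
    x^N≈x⇒x∈T {suc (suc N)} |T| (s≤s (s≤s _)) {x} xᴺ≈x with member? {X = T} |T| _≟_ x
    ... | yes x∈T = x∈T
    ... | no x∉T = contradiction root (roots≤degree (suc (suc N))
            (monic-linear N (- 1#) (monic-^ (suc (suc N)))) r r-injective)
      where
      r : Fin (suc (suc (suc N))) → Carrier
      r zero    = x
      r (suc i) = proj₁ (enum |T| i)
      r-injective : ∀ {i j} → r i ≈ r j → i ≡ j
      r-injective {zero}  {zero}  eq = ≡.refl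
      r-injective {zero}  {suc j} eq = contradiction (respect T (sym eq) (proj₂ (enum |T| j))) x∉T
      r-injective {suc i} {zero}  eq = contradiction (respect T eq (proj₂ (enum |T| i))) x∉T
      r-injective {suc i} {suc j} eq = ≡.cong suc (enum-injective |T| eq)
      fixed : ∀ i → r i ^ suc (suc N) ≈ r i
      fixed zero    = xᴺ≈x
      fixed (suc i) = fermat {T = T} 0∈T *-closed |T| (proj₂ (enum |T| i))
      root : ∀ i → r i ^ suc (suc N) + (- 1#) * r i ≈ 0#
      root i = modulo 1# (fixed i)
        (solve 2 (λ u v → (u :+ (:- :1) :* v) :- :0 := :1 :* (u :- v)) refl (r i ^ suc (suc N)) (r i))

  ^-fixed : ∀ {x} q → x ^ q ≈ x → ∀ k → x ^ (q ℕ.^ k) ≈ x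
  ^-fixed     q eq zero    = *-identityʳ _
  ^-fixed {x} q eq (suc k) = begin
    x ^ (q ℕ.* q ℕ.^ k)  ≈⟨ ^-assocʳ x q (q ℕ.^ k) ⟨
    (x ^ q) ^ (q ℕ.^ k)  ≈⟨ ^-congˡ (q ℕ.^ k) eq ⟩
    x ^ (q ℕ.^ k)        ≈⟨ ^-fixed q eq k ⟩
    x                    ∎
    where open Algebra.Properties.Semiring.Exp semiring using (^-assocʳ)

-- Linear algebra over a subfield: dimension as cardinality.

module LinearAlgebra {c ℓ} (𝔽 : Field c ℓ) (_≟_ : Decidable (Field._≈_ 𝔽)) where

  open Field 𝔽 hiding (zero)
  open Geometry 𝔽
  open FieldProperties 𝔽 _≟_
  open VectorEquality setoid using (_≋_; ≋-setoid; ≋-refl; ≋-sym; ≋-trans)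
  open CommutativeMonoidSum +-commutativeMonoid using (sum-cong-≋; ∑-distrib-+)
  open Algebra.Properties.Semiring.Sum semiring using (*-distribˡ-sum)

  private variable
    d r : ℕ
    p : Level

  infixl 6 _⊕_
  _⊕_ : Vector Carrier d → Vector Carrier d → Vector Carrier d
  (u ⊕ v) i = u i + v i

  -- The linear counterpart of a `PointSet`. It contains 𝟘, which is no point, so its size is an
  -- exact power of q.
  record IsSubspace (K : Subfield 𝔽) {d} (V : Subset (≋-setoid d) p) : Set (c ⊔ ℓ ⊔ p) where
    field
      𝟘-closed : 𝟘 ∈ V
      ⊕-closed : ∀ {u v} → u ∈ V → v ∈ V → u ⊕ v ∈ V
      ·-closed : ∀ {x v} → x ∈ₖ K → v ∈ V → x · v ∈ V

  combination-⊕ : ∀ xs ys (b : Vector (Vector Carrier d) r) →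
                  combination (λ j → xs j + ys j) b ≋ combination xs b ⊕ combination ys b
  combination-⊕ xs ys b i = trans (sum-cong-≋ (λ j → distribʳ (b j i) (xs j) (ys j)))
    (∑-distrib-+ (λ j → xs j * b j i) (λ j → ys j * b j i))

  combination-· : ∀ x xs (b : Vector (Vector Carrier d) r) →
                  combination (λ j → x * xs j) b ≋ x · combination xs b
  combination-· x xs b i = trans (sum-cong-≋ (λ j → *-assoc x (xs j) (b j i)))
    (sym (*-distribˡ-sum x (λ j → xs j * b j i)))

  combination-cong : ∀ {xs ys} (b : Vector (Vector Carrier d) r) → xs ≋ ys →
                     combination xs b ≋ combination ys b
  combination-cong b xs≋ys i = sum-cong-≋ (λ j → *-congʳ (xs≋ys j))

  combination-𝟘 : (b : Vector (Vector Carrier d) r) → combination 𝟘 b ≋ 𝟘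
  combination-𝟘 b i = trans (combination-cong b (λ j → sym (zeroˡ 0#)) i)
    (trans (combination-· 0# 𝟘 b i) (zeroˡ _))

  module _ (K : Subfield 𝔽) where

    open Subfield K hiding (subset)

    span : Vector (Vector Carrier d) r → Subset (≋-setoid d) (c ⊔ ℓ)
    span b = record
      { member  = λ w → ∃[ xs ] (∀ j → xs j ∈ₖ K) × w ≋ combination xs b
      ; respect = λ w≋w′ (xs , xs∈K , w≋) → xs , xs∈K , ≋-trans (≋-sym w≋w′) w≋
      }

    span-isSubspace : (b : Vector (Vector Carrier d) r) → IsSubspace K (span b)
    span-isSubspace b = record
      { 𝟘-closed = 𝟘 , (λ _ → 0-closed) , ≋-sym (combination-𝟘 b)
      ; ⊕-closed = λ (xs , xs∈K , u≋) (ys , ys∈K , v≋) →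
          (λ j → xs j + ys j) , (λ j → +-closed (xs∈K j) (ys∈K j)) ,
          λ i → trans (+-cong (u≋ i) (v≋ i)) (sym (combination-⊕ xs ys b i))
      ; ·-closed = λ {x} x∈K (xs , xs∈K , v≋) →
          (λ j → x * xs j) , (λ j → *-closed x∈K (xs∈K j)) ,
          λ i → trans (*-congˡ (v≋ i)) (sym (combination-· x xs b i))
      }

    combination-∈ : ∀ {r} {V : Subset (≋-setoid d) p} → IsSubspace K V →
                    (b : Vector (Vector Carrier d) r) → (∀ j → b j ∈ V) →
                    ∀ {xs} → (∀ j → xs j ∈ₖ K) → combination xs b ∈ V
    combination-∈ {r = zero}  V b b∈V xs∈K = IsSubspace.𝟘-closed V
    combination-∈ {r = suc r} V b b∈V xs∈K = IsSubspace.⊕-closed V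
      (IsSubspace.·-closed V (xs∈K zero) (b∈V zero))
      (combination-∈ V (b ∘ suc) (b∈V ∘ suc) (xs∈K ∘ suc))

    -- A relation with nonzero coefficient at w could be solved for w and would place it in the
    -- span; a relation without w is one among the old vectors.
    extend-independent : ∀ {w} (b : Vector (Vector Carrier d) r) → LinearlyIndependent K b →
                         ¬ w ∈ span b → LinearlyIndependent K (w ∷ b)
    extend-independent {w = w} b b-ind w∉b xs xs∈K xs·wb≋𝟘 = λ { zero → x₀≈0 ; (suc j) → rest≈0 j }
      where
      x₀ : Carrier
      x₀ = xs zero
      x₀≈0 : x₀ ≈ 0#
      x₀≈0 = decidable-stable (x₀ ≟ 0#) λ x₀≉0 → w∉b
        ( (λ j → (- x₀ ⁻¹) * xs (suc j))
        , (λ j → *-closed (neg-closed (inverse-closed (xs∈K zero) (x*x⁻¹≈1 x₀≉0))) (xs∈K (suc j)))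
        , λ i → sym (trans (combination-· (- x₀ ⁻¹) (xs ∘ suc) b i)
            (modulo₂ (w i) (- x₀ ⁻¹) (x*x⁻¹≈1 x₀≉0) (xs·wb≋𝟘 i)
              (solve 4 (λ x y w s → (:- y) :* s :- w :=
                 w :* (x :* y :- :1) :+ (:- y) :* ((x :* w :+ s) :- :0)) refl
                 x₀ (x₀ ⁻¹) (w i) (combination (xs ∘ suc) b i)))) )
      rest≈0 : xs ∘ suc ≋ 𝟘
      rest≈0 = b-ind (xs ∘ suc) (xs∈K ∘ suc) λ i →
        trans (sym (trans (+-congʳ (trans (*-congʳ x₀≈0) (zeroˡ (w i)))) (+-identityˡ _))) (xs·wb≋𝟘 i)

    module _ {q N} (|K| : HasSize (elements (Subfield.subset K)) q)
             (|𝔽| : HasSize setoid N) where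

      private
        _≟ᵥ_ : Decidable (_≋_ {d})
        _≟ᵥ_ {d} = finite⇒dec {A = ≋-setoid d} (vector-size {A = setoid} |𝔽| d)

      abstract
        span-size : (b : Vector (Vector Carrier d) r) → LinearlyIndependent K b →
                    HasSize (elements (span b)) (q ℕ.^ r)
        span-size {d} {r} b b-ind = transport-size
          {A = VectorEquality.≋-setoid (elements (Subfield.subset K)) r} {B = elements (span b)}
          (λ xs → combination (proj₁ ∘ xs) b , proj₁ ∘ xs , proj₂ ∘ xs , ≋-refl)
          (λ {xs} {ys} eq → λ j → x-y≈0⇒x≈y (trans
            (+-congˡ (solve 1 (λ y → :- y := (:- :1) :* y) refl (proj₁ (ys j))))
            (b-ind (λ j → proj₁ (xs j) + (- 1#) * proj₁ (ys j))
            (λ j → +-closed (proj₂ (xs j)) (*-closed (neg-closed 1-closed) (proj₂ (ys j))))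
            (λ i → trans (combination-⊕ (proj₁ ∘ xs) _ b i)
              (trans (+-congˡ (combination-· (- 1#) (proj₁ ∘ ys) b i))
              (modulo 1# (eq i) (solve 2 (λ x y → (x :+ (:- :1) :* y) :- :0 := :1 :* (x :- y)) refl
                 (combination (proj₁ ∘ xs) b i) (combination (proj₁ ∘ ys) b i))))) j)))
          (λ xs≋ys → combination-cong b xs≋ys)
          (λ (w , xs , xs∈K , w≋) → (λ j → xs j , xs∈K j) , ≋-sym w≋)
          (vector-size |K| r)

        -- While s < r, a span of s independent vectors has q^s < q^r elements, so V offers a vector
        -- outside it. After r steps the span is as large as V.
        basis : q ℕ.> 1 → (V : Subset (≋-setoid d) p) → IsSubspace K V →
                HasSize (elements V) (q ℕ.^ r) →
                Σ[ b ∈ Vector (Vector Carrier d) r ] LinearlyIndependent K b × span b ≐ V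
        basis {d} {r = r} q>1 V V-sub |V| = b , b-ind , b⊆V ,
          ⊆-size⇒⊇ {X = span b} (span-size b b-ind) {Y = V} |V| b⊆V
          where
          span⊆V : ∀ {s} (b : Vector (Vector Carrier d) s) → (∀ j → b j ∈ V) → span b ⊆ V
          span⊆V b b∈V w (xs , xs∈K , w≋) = respect V (≋-sym w≋) (combination-∈ V-sub b b∈V xs∈K)
          independent : ∀ s → s ℕ.≤ r →
            Σ[ b ∈ Vector (Vector Carrier d) s ] (∀ j → b j ∈ V) × LinearlyIndependent K b
          independent zero    _   = [] , (λ ()) , λ _ _ _ ()
          independent (suc s) s<r with independent s (ℕ.<⇒≤ s<r)
          ... | b , b∈V , b-ind with escape {A = ≋-setoid d} _≟ᵥ_ {U = span b} {V = V}
                  (span-size b b-ind) |V| (ℕ.^-monoʳ-< q q>1 s<r)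
          ... | w , w∈V , w∉b = w ∷ b , (λ { zero → w∈V ; (suc j) → b∈V j }) ,
                                extend-independent b b-ind w∉b
          b : Vector (Vector Carrier d) r
          b = proj₁ (independent r ℕ.≤-refl)
          b-ind : LinearlyIndependent K b
          b-ind = proj₂ (proj₂ (independent r ℕ.≤-refl))
          b⊆V : span b ⊆ V
          b⊆V = span⊆V b (proj₁ (proj₂ (independent r ℕ.≤-refl)))

      open PG K

      IsProjectivization : PointSet d → Subset (≋-setoid d) p → Set (c ⊔ ℓ ⊔ p)
      IsProjectivization X V = ∀ P → P ∈ X ⇔ proj₁ P ∈ V

      -- Together with `subspace⇒dimension` this exchanges projective dimension r - 1 for the count
      -- q^r, the only form in which dimensions are used below.
      dimension⇒subspace : (X : PointSet d) → _is⟨_-1⟩-dimensional d X r →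
        Σ[ V ∈ Subset (≋-setoid d) (c ⊔ ℓ) ] IsSubspace K V ×
          HasSize (elements V) (q ℕ.^ r) × IsProjectivization X V
      dimension⇒subspace X (b , b-ind , X⇔b) = span b , span-isSubspace b , span-size b b-ind , X⇔b

      subspace⇒dimension : q ℕ.> 1 → (X : PointSet d) (V : Subset (≋-setoid d) p) → IsSubspace K V →
        HasSize (elements V) (q ℕ.^ r) → IsProjectivization X V → _is⟨_-1⟩-dimensional d X r
      subspace⇒dimension q>1 X V V-sub |V| X⇔V with basis q>1 V V-sub |V|
      ... | b , b-ind , b⊆V , V⊆b = b , b-ind , λ P → mk⇔
        (λ P∈X → V⊆b _ (Equivalence.to (X⇔V P) P∈X))
        (λ P∈b → Equivalence.from (X⇔V P) (b⊆V _ P∈b))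

-- The projective line over 𝔽: determinants, spread elements, sublines and slopes.

module Plane {c ℓ} (𝔽 : Field c ℓ) (_≟_ : Decidable (Field._≈_ 𝔽)) (ground : Subfield 𝔽) where

  open Field 𝔽 hiding (zero)
  open Geometry 𝔽
  open FieldProperties 𝔽 _≟_
  open LinearAlgebra 𝔽 _≟_ using (_⊕_)
  open VectorEquality setoid using (_≋_; ≋-setoid; ≋-refl; ≋-sym; ≋-trans)
  open H∞ ground

  private
    L = c ⊔ ℓ
    V₂ = Vector Carrier 2

  infix 4 _≅_
  -- A record, so that X and Y can be recovered from a proof of X ≅ Y.
  record _≅_ (X Y : PointSet) : Set L where
    constructor ≐⇒≅
    field ≅⇒≐ : X ≐ Y
  open _≅_ public

  ≅-refl : ∀ {X} → X ≅ X
  ≅-refl {X} = ≐⇒≅ (Setoid.refl pointSets {X})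
  ≅-sym : ∀ {X Y} → X ≅ Y → Y ≅ X
  ≅-sym {X} {Y} (≐⇒≅ p) = ≐⇒≅ (Setoid.sym pointSets {X} {Y} p)
  ≅-trans : ∀ {X Y Z} → X ≅ Y → Y ≅ Z → X ≅ Z
  ≅-trans {X} {Y} {Z} (≐⇒≅ p) (≐⇒≅ q) = ≐⇒≅ (Setoid.trans pointSets {X} {Y} {Z} p q)

  infix 4 _≉𝟘
  _≉𝟘 : V₂ → Set ℓ
  w ≉𝟘 = ¬ w ≋ 𝟘

  det : V₂ → V₂ → Carrier
  det u v = u 0F * v 1F - u 1F * v 0F

  at-01 : ∀ {p} {Q : Fin 2 → Set p} → Q 0F → Q 1F → ∀ i → Q i
  at-01 q₀ q₁ zero       = q₀
  at-01 q₀ q₁ (suc zero) = q₁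

  det-cong : ∀ {u u′ v v′} → u ≋ u′ → v ≋ v′ → det u v ≈ det u′ v′
  det-cong u≋ v≋ = +-cong (*-cong (u≋ 0F) (v≋ 1F)) (-‿cong (*-cong (u≋ 1F) (v≋ 0F)))

  det-linear : ∀ u v s t s′ t′ →
               det (s · u ⊕ t · v) (s′ · u ⊕ t′ · v) ≈ (s * t′ - t * s′) * det u v
  det-linear u v s t s′ t′ = solve 8 (λ u₀ u₁ v₀ v₁ s t s′ t′ →
    (s :* u₀ :+ t :* v₀) :* (s′ :* u₁ :+ t′ :* v₁) :- (s :* u₁ :+ t :* v₁) :* (s′ :* u₀ :+ t′ :* v₀)
      := (s :* t′ :- t :* s′) :* (u₀ :* v₁ :- u₁ :* v₀)) refl
    (u 0F) (u 1F) (v 0F) (v 1F) s t s′ t′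

  det-scale : ∀ α β a b → α * β * det a b ≈ det (α · a) (β · b)
  det-scale α β a b = solve 6 (λ α β a₀ a₁ b₀ b₁ → (α :* β) :* (a₀ :* b₁ :- a₁ :* b₀) :=
    (α :* a₀) :* (β :* b₁) :- (α :* a₁) :* (β :* b₀)) refl α β (a 0F) (a 1F) (b 0F) (b 1F)

  coordinates-unique : ∀ {u v} → det u v ≉0 → ∀ {s t s′ t′} →
                       s · u ⊕ t · v ≋ s′ · u ⊕ t′ · v → s ≈ s′ × t ≈ t′
  coordinates-unique {u} {v} D≉0 {s} {t} {s′} {t′} eq =
    *-cancelˡ-≉0 D≉0 (modulo₂ (v 1F) (- v 0F) (eq 0F) (eq 1F)
      (solve 8 (λ u₀ u₁ v₀ v₁ s t s′ t′ →
        (u₀ :* v₁ :- u₁ :* v₀) :* s :- (u₀ :* v₁ :- u₁ :* v₀) :* s′ :=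
        v₁ :* ((s :* u₀ :+ t :* v₀) :- (s′ :* u₀ :+ t′ :* v₀)) :+
        (:- v₀) :* ((s :* u₁ :+ t :* v₁) :- (s′ :* u₁ :+ t′ :* v₁))) refl
        (u 0F) (u 1F) (v 0F) (v 1F) s t s′ t′)) ,
    *-cancelˡ-≉0 D≉0 (modulo₂ (- u 1F) (u 0F) (eq 0F) (eq 1F)
      (solve 8 (λ u₀ u₁ v₀ v₁ s t s′ t′ →
        (u₀ :* v₁ :- u₁ :* v₀) :* t :- (u₀ :* v₁ :- u₁ :* v₀) :* t′ :=
        (:- u₁) :* ((s :* u₀ :+ t :* v₀) :- (s′ :* u₀ :+ t′ :* v₀)) :+
        u₀ :* ((s :* u₁ :+ t :* v₁) :- (s′ :* u₁ :+ t′ :* v₁))) refl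
        (u 0F) (u 1F) (v 0F) (v 1F) s t s′ t′))

  combination≋𝟘 : ∀ {u v} → det u v ≉0 → ∀ {s t} → s · u ⊕ t · v ≋ 𝟘 → s ≈ 0# × t ≈ 0#
  combination≋𝟘 {u} {v} D≉0 eq = coordinates-unique D≉0 (≋-trans eq
    (λ i → solve 2 (λ u v → :0 := :0 :* u :+ :0 :* v) refl (u i) (v i)))

  cramer : ∀ {u v} → det u v ≉0 → ∀ w → w ≋ (det w v * det u v ⁻¹) · u ⊕ (det u w * det u v ⁻¹) · v
  cramer {u} {v} D≉0 w = at-01
    (modulo (- w 0F) (x*x⁻¹≈1 D≉0)
      (solve 7 (λ u₀ u₁ v₀ v₁ w₀ w₁ i →
        w₀ :- (((w₀ :* v₁ :- w₁ :* v₀) :* i) :* u₀ :+ ((u₀ :* w₁ :- u₁ :* w₀) :* i) :* v₀)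
          := (:- w₀) :* ((u₀ :* v₁ :- u₁ :* v₀) :* i :- :1)) refl
        (u 0F) (u 1F) (v 0F) (v 1F) (w 0F) (w 1F) (det u v ⁻¹)))
    (modulo (- w 1F) (x*x⁻¹≈1 D≉0)
      (solve 7 (λ u₀ u₁ v₀ v₁ w₀ w₁ i →
        w₁ :- (((w₀ :* v₁ :- w₁ :* v₀) :* i) :* u₁ :+ ((u₀ :* w₁ :- u₁ :* w₀) :* i) :* v₁)
          := (:- w₁) :* ((u₀ :* v₁ :- u₁ :* v₀) :* i :- :1)) refl
        (u 0F) (u 1F) (v 0F) (v 1F) (w 0F) (w 1F) (det u v ⁻¹)))

  Multiple : V₂ → V₂ → Set L
  Multiple a b = ∃[ x ] x ≉0 × a ≋ x · b

  det≈0⇒multiple : ∀ {a b} → a ≉𝟘 → b ≉𝟘 → det a b ≈ 0# → Multiple a b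
  det≈0⇒multiple {a} {b} a≉𝟘 b≉𝟘 D≈0 with b 0F ≟ 0#
  ... | no b₀≉0 = a 0F * b 0F ⁻¹ , (λ x≈0 → a≉𝟘 (≋-trans a≋ (λ i → trans (*-congʳ x≈0) (zeroˡ _)))) , a≋
    where
    a≋ : a ≋ (a 0F * b 0F ⁻¹) · b
    a≋ = at-01
      (modulo (- a 0F) (x*x⁻¹≈1 b₀≉0)
        (solve 3 (λ a₀ b₀ i → a₀ :- (a₀ :* i) :* b₀ := (:- a₀) :* (b₀ :* i :- :1)) refl
           (a 0F) (b 0F) (b 0F ⁻¹)))
      (modulo₂ (- a 1F) (- b 0F ⁻¹) (x*x⁻¹≈1 b₀≉0) D≈0
        (solve 5 (λ a₀ a₁ b₀ b₁ i → a₁ :- (a₀ :* i) :* b₁ :=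
          (:- a₁) :* (b₀ :* i :- :1) :+ (:- i) :* ((a₀ :* b₁ :- a₁ :* b₀) :- :0)) refl
          (a 0F) (a 1F) (b 0F) (b 1F) (b 0F ⁻¹)))
  ... | yes b₀≈0 = a 1F * b 1F ⁻¹ , (λ x≈0 → a≉𝟘 (≋-trans a≋ (λ i → trans (*-congʳ x≈0) (zeroˡ _)))) , a≋
    where
    b₁≉0 : b 1F ≉0
    b₁≉0 b₁≈0 = b≉𝟘 (at-01 b₀≈0 b₁≈0)
    a≋ : a ≋ (a 1F * b 1F ⁻¹) · b
    a≋ = at-01
      (modulo₂ (- a 0F) (b 1F ⁻¹) (x*x⁻¹≈1 b₁≉0) D≈0
        (solve 5 (λ a₀ a₁ b₀ b₁ i → a₀ :- (a₁ :* i) :* b₀ :=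
          (:- a₀) :* (b₁ :* i :- :1) :+ i :* ((a₀ :* b₁ :- a₁ :* b₀) :- :0)) refl
          (a 0F) (a 1F) (b 0F) (b 1F) (b 1F ⁻¹)))
      (modulo (- a 1F) (x*x⁻¹≈1 b₁≉0)
        (solve 3 (λ a₀ b₀ i → a₀ :- (a₀ :* i) :* b₀ := (:- a₀) :* (b₀ :* i :- :1)) refl
           (a 1F) (b 1F) (b 1F ⁻¹)))

  multiple⇒det≈0 : ∀ {a b} → Multiple a b → det a b ≈ 0#
  multiple⇒det≈0 {a} {b} (x , _ , a≋xb) = trans (det-cong a≋xb (≋-refl {x = b}))
    (solve 3 (λ x b₀ b₁ → (x :* b₀) :* b₁ :- (x :* b₁) :* b₀ := :0) refl x (b 0F) (b 1F))

  ·-≉𝟘 : ∀ {x w} → x ≉0 → w ≉𝟘 → x · w ≉𝟘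
  ·-≉𝟘 x≉0 w≉𝟘 xw≋𝟘 = w≉𝟘 (λ i → xy≈0⇒y≈0 x≉0 (xw≋𝟘 i))

  ≉𝟘⇒≉0 : ∀ {x w u} → u ≉𝟘 → u ≋ x · w → x ≉0
  ≉𝟘⇒≉0 u≉𝟘 u≋ x≈0 = u≉𝟘 (λ i → trans (u≋ i) (trans (*-congʳ x≈0) (zeroˡ _)))

  Block : V₂ → PointSet
  Block = block whole

  ∈Block⇒ : ∀ {w} P → P ∈ Block w → Multiple (proj₁ P) w
  ∈Block⇒ (u , u≉𝟘) (x , _ , x≉0 , y , _ , y≉0 , u≋) =
    y * x , *-≉0 y≉0 x≉0 , λ i → trans (u≋ i) (sym (*-assoc y x _))

  ⇒∈Block : ∀ {w} P {x} → proj₁ P ≋ x · w → P ∈ Block w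
  ⇒∈Block P {x} P≋ = x , _ , ≉𝟘⇒≉0 (proj₂ P) P≋ , 1# , Subfield.1-closed ground , 1≉0 ,
    λ i → trans (P≋ i) (sym (*-identityˡ _))

  multiple⇒Block-⊆ : ∀ {a b} → Multiple a b → Block a ⊆ Block b
  multiple⇒Block-⊆ (x , x≉0 , a≋xb) P P∈a with ∈Block⇒ P P∈a
  ... | y , _ , P≋ya = ⇒∈Block P {y * x} λ i →
    trans (P≋ya i) (trans (*-congˡ (a≋xb i)) (sym (*-assoc y x _)))

  multiple-sym : ∀ {a b} → Multiple a b → Multiple b a
  multiple-sym {a} {b} (x , x≉0 , a≋xb) = x ⁻¹ , ⁻¹-≉0 x≉0 , λ i →
    modulo₂ (- b i) (- x ⁻¹) (x*x⁻¹≈1 x≉0) (a≋xb i)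
      (solve 4 (λ x j a b → b :- j :* a := (:- b) :* (x :* j :- :1) :+ (:- j) :* (a :- x :* b)) refl
        x (x ⁻¹) (a i) (b i))

  multiple⇒Block-≅ : ∀ {a b} → Multiple a b → Block a ≅ Block b
  multiple⇒Block-≅ m = ≐⇒≅ (multiple⇒Block-⊆ m , multiple⇒Block-⊆ (multiple-sym m))

  ≋⇒Block-≅ : ∀ {a b} → a ≋ b → Block a ≅ Block b
  ≋⇒Block-≅ a≋b = multiple⇒Block-≅ (1# , 1≉0 , λ i → trans (a≋b i) (sym (*-identityˡ _)))

  ∈Block-self : ∀ {a} (a≉𝟘 : a ≉𝟘) → (a , a≉𝟘) ∈ Block a
  ∈Block-self a≉𝟘 = ⇒∈Block (_ , a≉𝟘) (λ i → sym (*-identityˡ _))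

  Block-⊆⇒multiple : ∀ {a b} → a ≉𝟘 → Block a ⊆ Block b → Multiple a b
  Block-⊆⇒multiple {a} a≉𝟘 a⊆b = ∈Block⇒ (a , a≉𝟘) (a⊆b (a , a≉𝟘) (∈Block-self a≉𝟘))

  module _ (K : Subfield 𝔽) where

    open Subfield K hiding (subset)

    ⁻¹-closed : ∀ {x} → x ≉0 → x ∈ₖ K → x ⁻¹ ∈ₖ K
    ⁻¹-closed x≉0 x∈K = inverse-closed x∈K (x*x⁻¹≈1 x≉0)

    minor-closed : ∀ {a b c d} → a ∈ₖ K → b ∈ₖ K → c ∈ₖ K → d ∈ₖ K → a * b - c * d ∈ₖ K
    minor-closed a b c d = +-closed (*-closed a b) (neg-closed (*-closed c d))

    record Span₂ (u v w : V₂) : Set L where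
      constructor spans
      field
        {s t} : Carrier
        s∈K : s ∈ₖ K
        t∈K : t ∈ₖ K
        equation : w ≋ s · u ⊕ t · v

    Span₂-trans : ∀ {u v a b w} → Span₂ u v a → Span₂ u v b → Span₂ a b w → Span₂ u v w
    Span₂-trans {u} {v} (spans {a₁} {a₂} a₁∈ a₂∈ a≋) (spans {b₁} {b₂} b₁∈ b₂∈ b≋) (spans {s} {t} s∈ t∈ w≋) =
      spans (+-closed (*-closed s∈ a₁∈) (*-closed t∈ b₁∈)) (+-closed (*-closed s∈ a₂∈) (*-closed t∈ b₂∈)) λ i →
        trans (w≋ i) (trans (+-cong (*-congˡ (a≋ i)) (*-congˡ (b≋ i)))
        (solve 8 (λ s t a₁ a₂ b₁ b₂ u v →
          s :* (a₁ :* u :+ a₂ :* v) :+ t :* (b₁ :* u :+ b₂ :* v) :=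
          (s :* a₁ :+ t :* b₁) :* u :+ (s :* a₂ :+ t :* b₂) :* v) refl s t a₁ a₂ b₁ b₂ (u i) (v i)))

    -- Cramer's rule for the coordinate pairs with respect to u and v: their minors lie in K,
    -- whereas determinants of the vectors themselves need only lie in 𝔽. The divisor k is nonzero
    -- because det a b = k det u v.
    Span₂-exchange : ∀ {u v a b w} → Span₂ u v a → Span₂ u v b → det a b ≉0 → Span₂ u v w → Span₂ a b w
    Span₂-exchange {u} {v} (spans {a₁} {a₂} a₁∈ a₂∈ a≋) (spans {b₁} {b₂} b₁∈ b₂∈ b≋) D≉0
                   (spans {w₁} {w₂} w₁∈ w₂∈ w≋) =
      spans (*-closed (minor-closed w₁∈ b₂∈ w₂∈ b₁∈) k⁻¹∈) (*-closed (minor-closed a₁∈ w₂∈ a₂∈ w₁∈) k⁻¹∈) λ i →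
        trans (w≋ i) (trans
        (modulo (- (w₁ * u i + w₂ * v i)) (x*x⁻¹≈1 k≉0)
          (solve 9 (λ a₁ a₂ b₁ b₂ w₁ w₂ u v j →
            (w₁ :* u :+ w₂ :* v) :-
              (((w₁ :* b₂ :- w₂ :* b₁) :* j) :* (a₁ :* u :+ a₂ :* v) :+
               ((a₁ :* w₂ :- a₂ :* w₁) :* j) :* (b₁ :* u :+ b₂ :* v)) :=
            (:- (w₁ :* u :+ w₂ :* v)) :* ((a₁ :* b₂ :- a₂ :* b₁) :* j :- :1)) refl
            a₁ a₂ b₁ b₂ w₁ w₂ (u i) (v i) (k ⁻¹)))
        (+-cong (*-congˡ (sym (a≋ i))) (*-congˡ (sym (b≋ i)))))
      where
      k k₁ k₂ : Carrier
      k  = a₁ * b₂ - a₂ * b₁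
      k₁ = w₁ * b₂ - w₂ * b₁
      k₂ = a₁ * w₂ - a₂ * w₁
      k≉0 : k ≉0
      k≉0 = ≉0ˡ (≉0-resp (trans (det-cong a≋ b≋) (det-linear u v a₁ a₂ b₁ b₂)) D≉0)
      k⁻¹∈ : k ⁻¹ ∈ₖ K
      k⁻¹∈ = ⁻¹-closed k≉0 (minor-closed a₁∈ b₂∈ a₂∈ b₁∈)

    Span₂-scale : ∀ {u v a x} → x ∈ₖ K → Span₂ u v a → Span₂ u v (x · a)
    Span₂-scale {x = x} x∈ (spans {a₁} {a₂} a₁∈ a₂∈ a≋) =
      spans (*-closed x∈ a₁∈) (*-closed x∈ a₂∈) λ i →
        trans (*-congˡ (a≋ i)) (trans (distribˡ x _ _) (+-cong (sym (*-assoc x a₁ _)) (sym (*-assoc x a₂ _))))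

    -- The 𝒟-elements φ(m) for the K-subline m through ⟨u⟩, ⟨v⟩ and ⟨u + v⟩.
    Subline : V₂ → V₂ → Subset pointSets L
    Subline u v = record
      { member  = λ X → ∃[ w ] w ≉𝟘 × Span₂ u v w × X ≅ Block w
      ; respect = λ {X} {Y} X≐Y (w , w≉𝟘 , w∈ , X≅w) → w , w≉𝟘 , w∈ , ≅-trans (≅-sym {X} {Y} (≐⇒≅ X≐Y)) X≅w
      }

    Subline-≐ : ∀ {u v a b} → Span₂ u v a → Span₂ u v b → det a b ≉0 → Subline u v ≐ Subline a b
    Subline-≐ a∈ b∈ D≉0 =
      (λ X (w , w≉𝟘 , w∈ , X≅w) → w , w≉𝟘 , Span₂-exchange a∈ b∈ D≉0 w∈ , X≅w) ,
      (λ X (w , w≉𝟘 , w∈ , X≅w) → w , w≉𝟘 , Span₂-trans a∈ b∈ w∈ , X≅w)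

    -- Coordinates in which A, B, C become the points 0, ∞ and 1 of the same K-subline. Used for K =
    -- `whole` to coordinatise S, for K = 𝔽qᵏ to locate reguli in S, and for K = 𝔽q to study a
    -- regulus.
    record Frame (u v : V₂) (A B C : PointSet) : Set (Level.suc L) where
      field
        {e f} : V₂
        independent : det e f ≉0
        same : Subline u v ≐ Subline e f
        A≅ : A ≅ Block e
        B≅ : B ≅ Block f
        C≅ : C ≅ Block (e ⊕ f)

    private
      det≉0 : ∀ {A B a b} → a ≉𝟘 → b ≉𝟘 → A ≅ Block a → B ≅ Block b → ¬ A ≐ B → det a b ≉0
      det≉0 a≉𝟘 b≉𝟘 A≅a B≅b A≢B D≈0 = A≢B (≅⇒≐
        (≅-trans A≅a (≅-trans (multiple⇒Block-≅ (det≈0⇒multiple a≉𝟘 b≉𝟘 D≈0)) (≅-sym B≅b))))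

      coefficient≉0 : ∀ {A C a b c α β} → c ≉𝟘 → A ≅ Block a → C ≅ Block c → ¬ A ≐ C →
                      c ≋ α · a ⊕ β · b → β ≉0
      coefficient≉0 {a = a} {b} {c} {α} {β} c≉𝟘 A≅a C≅c A≢C c≋ β≈0 = A≢C (≅⇒≐
        (≅-trans A≅a (≅-trans (≅-sym (multiple⇒Block-≅ (α , ≉𝟘⇒≉0 c≉𝟘 c≋αa , c≋αa))) (≅-sym C≅c))))
        where
        c≋αa : c ≋ α · a
        c≋αa i = trans (c≋ i) (trans (+-congˡ (trans (*-congʳ β≈0) (zeroˡ _))) (+-identityʳ _))

    abstract
      -- Write c = α a + β b and take e = α a, f = β b. Neither coefficient vanishes, since C
      -- differs from B and from A.
      frame : ∀ {u v A B C} → A ∈ Subline u v → B ∈ Subline u v → C ∈ Subline u v →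
              PairwiseDistinct A B C → Frame u v A B C
      frame {u} {v} {A} {B} {C} (a , a≉𝟘 , a∈ , A≅a) (b , b≉𝟘 , b∈ , B≅b) (c , c≉𝟘 , c∈ , C≅c)
            (A≢B , A≢C , B≢C) = record
        { independent = D′≉0
        ; same = Subline-≐ (Span₂-scale α∈ a∈) (Span₂-scale β∈ b∈) D′≉0
        ; A≅ = ≅-trans A≅a (≅-sym (multiple⇒Block-≅ (α , α≉0 , ≋-refl)))
        ; B≅ = ≅-trans B≅b (≅-sym (multiple⇒Block-≅ (β , β≉0 , ≋-refl)))
        ; C≅ = ≅-trans C≅c (≋⇒Block-≅ c≋)
        }
        where
        D≉0 : det a b ≉0
        D≉0 = det≉0 {A} {B} a≉𝟘 b≉𝟘 A≅a B≅b A≢B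
        open Span₂ (Span₂-exchange a∈ b∈ D≉0 c∈) using () renaming
          (s to α; t to β; s∈K to α∈; t∈K to β∈; equation to c≋)
        α≉0 : α ≉0
        α≉0 = coefficient≉0 {B} {C} c≉𝟘 B≅b C≅c B≢C (λ i → trans (c≋ i) (+-comm _ _))
        β≉0 : β ≉0
        β≉0 = coefficient≉0 {A} {C} c≉𝟘 A≅a C≅c A≢C c≋
        D′≉0 : det (α · a) (β · b) ≉0
        D′≉0 = ≉0-resp (det-scale α β a b) (*-≉0 (*-≉0 α≉0 β≉0) D≉0)

  -- Slope t is the point ⟨u + t v⟩; together with ⟨v⟩ these are all points.
  module _ {u v : V₂} (D≉0 : det u v ≉0) where

    private
      u≋ : u ≋ 1# · u ⊕ 0# · v
      u≋ i = solve 2 (λ u v → u := :1 :* u :+ :0 :* v) refl (u i) (v i)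
      v≋ : v ≋ 0# · u ⊕ 1# · v
      v≋ i = solve 2 (λ u v → v := :0 :* u :+ :1 :* v) refl (u i) (v i)
      slope≋ : ∀ t → u ⊕ t · v ≋ 1# · u ⊕ t · v
      slope≋ t i = +-congʳ (sym (*-identityˡ _))

    combination-≉𝟘 : ∀ {s t} → ¬ (s ≈ 0# × t ≈ 0#) → s · u ⊕ t · v ≉𝟘
    combination-≉𝟘 st≉0 eq = st≉0 (combination≋𝟘 D≉0 eq)

    v≉𝟘 : v ≉𝟘
    v≉𝟘 v≋𝟘 = 1≉0 (proj₂ (combination≋𝟘 D≉0 (≋-trans (≋-sym v≋) v≋𝟘)))

    u≉𝟘 : u ≉𝟘
    u≉𝟘 u≋𝟘 = 1≉0 (proj₁ (combination≋𝟘 D≉0 (≋-trans (≋-sym u≋) u≋𝟘)))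

    slope-≉𝟘 : ∀ t → u ⊕ t · v ≉𝟘
    slope-≉𝟘 t eq = 1≉0 (proj₁ (combination≋𝟘 D≉0 (≋-trans (≋-sym (slope≋ t)) eq)))

    slope-injective : ∀ {s t} → Block (u ⊕ s · v) ⊆ Block (u ⊕ t · v) → s ≈ t
    slope-injective {s} {t} s⊆t =
      let x , _ , eq  = Block-⊆⇒multiple {u ⊕ s · v} {u ⊕ t · v} (slope-≉𝟘 s) s⊆t
          1≈x , s≈xt = coordinates-unique D≉0 {1#} {s} {x} {x * t} (≋-trans (≋-sym (slope≋ s)) (≋-trans eq
            (λ i → solve 4 (λ x t u v → x :* (u :+ t :* v) := x :* u :+ (x :* t) :* v) refl x t (u i) (v i))))
      in trans s≈xt (trans (*-congʳ (sym 1≈x)) (*-identityˡ t))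

    slope≢∞ : ∀ {s} → ¬ Block (u ⊕ s · v) ⊆ Block v
    slope≢∞ {s} s⊆∞ =
      let x , _ , eq = Block-⊆⇒multiple {u ⊕ s · v} {v} (slope-≉𝟘 s) s⊆∞
      in 1≉0 (proj₁ (coordinates-unique D≉0 {1#} {s} {0#} {x} (≋-trans (≋-sym (slope≋ s)) (≋-trans eq
           (λ i → solve 3 (λ x u v → x :* v := :0 :* u :+ x :* v) refl x (u i) (v i))))))

    module _ (K : Subfield 𝔽) where

      open Subfield K hiding (subset)

      ∞∈Subline : Block v ∈ Subline K u v
      ∞∈Subline = v , v≉𝟘 , spans 0-closed 1-closed v≋ , ≅-refl

      slope∈Subline : ∀ {t} → t ∈ₖ K → Block (u ⊕ t · v) ∈ Subline K u v
      slope∈Subline {t} t∈K = u ⊕ t · v , slope-≉𝟘 t , spans 1-closed t∈K (slope≋ t) , ≅-refl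

      Subline⇒slope : ∀ {X} → X ∈ Subline K u v → X ≅ Block v ⊎ ∃[ t ] t ∈ₖ K × X ≅ Block (u ⊕ t · v)
      Subline⇒slope {X} (w , w≉𝟘 , (spans {s} {t} s∈ t∈ w≋) , X≅w) with s ≟ 0#
      ... | yes s≈0 = inj₁ (≅-trans X≅w (multiple⇒Block-≅ (t , ≉𝟘⇒≉0 w≉𝟘 w≋tv , w≋tv)))
        where
        w≋tv : w ≋ t · v
        w≋tv i = trans (w≋ i) (trans (+-congʳ (trans (*-congʳ s≈0) (zeroˡ _))) (+-identityˡ _))
      ... | no s≉0 = inj₂ (t * s ⁻¹ , *-closed t∈ (⁻¹-closed K s≉0 s∈) ,
              ≅-trans X≅w (multiple⇒Block-≅ (s , s≉0 , λ i → trans (w≋ i) (modulo (- (t * v i)) (x*x⁻¹≈1 s≉0)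
                (solve 5 (λ s t j u v →
                  (s :* u :+ t :* v) :- s :* (u :+ (t :* j) :* v) := (:- (t :* v)) :* (s :* j :- :1))
                   refl s t (s ⁻¹) (u i) (v i))))))

      abstract
        Subline-size : ∀ {q} → HasSize (elements (Subfield.subset K)) q → HasSize (elements (Subline K u v)) (suc q)
        Subline-size {q} |K| = fromEnumeration {A = elements (Subline K u v)} e e-inj e-surj
          where
          e : Fin (suc q) → ∃ (member (Subline K u v))
          e zero    = Block v , ∞∈Subline
          e (suc i) = let t , t∈K = enum |K| i in Block (u ⊕ t · v) , slope∈Subline t∈K
          e-inj : ∀ {i j} → proj₁ (e i) ≐ proj₁ (e j) → i ≡ j
          e-inj {zero}  {zero}  eq       = ≡.refl
          e-inj {zero}  {suc j} (_ , X⊇Y) = contradiction X⊇Y slope≢∞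
          e-inj {suc i} {zero}  (X⊆Y , _) = contradiction X⊆Y slope≢∞
          e-inj {suc i} {suc j} (X⊆Y , _) = ≡.cong suc (enum-injective |K| (slope-injective X⊆Y))
          e-surj : ∀ ((X , _) : ∃ (member (Subline K u v))) → ∃[ i ] proj₁ (e i) ≐ X
          e-surj (X , X∈) with Subline⇒slope X∈
          ... | inj₁ X≅v = zero , ≅⇒≐ (≅-sym X≅v)
          ... | inj₂ (t , t∈K , X≅t) = suc (index |K| (t , t∈K)) ,
            ≅⇒≐ (≅-trans (≋⇒Block-≅ (λ i → +-congˡ (*-congʳ (enum-index |K| (t , t∈K))))) (≅-sym X≅t))

  -- Over all of 𝔽 a subline is the full projective line, so S receives coordinates before anything
  -- else is known about it.
  𝒟⊆Subline : ∀ {u v} → det u v ≉0 → 𝒟 ⊆ Subline whole u v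
  𝒟⊆Subline D≉0 X (w , w≉𝟘 , X≐w) = w , w≉𝟘 , spans _ _ (cramer D≉0 w) , ≐⇒≅ X≐w

-- Reguli are 𝔽q-sublines: existence and uniqueness.

module Reguli {c ℓ} (𝔽 : Field c ℓ) (_≟_ : Decidable (Field._≈_ 𝔽)) (𝔽q : Subfield 𝔽)
  {q n : ℕ} (q>1 : q ℕ.> 1)
  (|𝔽| : HasSize (Field.setoid 𝔽) (q ℕ.^ n))
  (|𝔽q| : HasSize (elements (Subfield.subset 𝔽q)) q) where

  open Field 𝔽 hiding (zero)
  open Geometry 𝔽
  open FieldProperties 𝔽 _≟_
  open LinearAlgebra 𝔽 _≟_
  open Plane 𝔽 _≟_ 𝔽q
  open VectorEquality setoid using (_≋_; ≋-setoid; ≋-refl; ≋-sym; ≋-trans)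
  open H∞ 𝔽q
  open Subfield 𝔽q hiding (subset)

  private
    L = c ⊔ ℓ
    V₂ = Vector Carrier 2

  -- The M N sums x u + y v are distinct and lie in V, which has no more than M N elements. It
  -- serves for lines, with q^2 vectors, and for the space W of the third condition.
  exhaust-coordinates : ∀ {p r s M N} {A : Subset setoid p} {B : Subset setoid r} {V : Subset (≋-setoid 2) s} →
    HasSize (elements A) M → HasSize (elements B) N → HasSize (elements V) (M ℕ.* N) →
    ∀ {u v} → det u v ≉0 → (∀ {x y} → x ∈ A → y ∈ B → x · u ⊕ y · v ∈ V) →
    ∀ {w} → w ∈ V → ∃₂ λ x y → x ∈ A × y ∈ B × w ≋ x · u ⊕ y · v
  exhaust-coordinates {A = A} {B} {V} |A| |B| |V| {u} {v} D≉0 ⊆V {w} w∈V =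
    let ((x , x∈A) , (y , y∈B)) , eq = injective⇒surjective
          {A = ×-setoid (elements A) (elements B)} {B = elements V}
          (λ ((x , x∈A) , (y , y∈B)) → x · u ⊕ y · v , ⊆V x∈A y∈B)
          (coordinates-unique D≉0) (×-size |A| |B|) |V| (w , w∈V)
    in x , y , x∈A , y∈B , ≋-sym eq

  ·-injective : ∀ {w} → w ≉𝟘 → ∀ {x y} → x · w ≋ y · w → x ≈ y
  ·-injective {w} w≉𝟘 {x} {y} eq = decidable-stable (x ≟ y) λ x≉y →
    ·-≉𝟘 (λ x-y≈0 → x≉y (x-y≈0⇒x≈y x-y≈0)) w≉𝟘 λ i → modulo 1# (eq i)
      (solve 3 (λ x y w → (x :- y) :* w :- :0 := :1 :* (x :* w :- y :* w)) refl x y (w i))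

  module _ (K : Subfield 𝔽) where

    open Subfield K using () renaming (subset to ⟨K⟩; 0-closed to 0∈; +-closed to +∈; *-closed to *∈)

    combinations : V₂ → V₂ → Subset (≋-setoid 2) L
    combinations u v = record
      { member  = Span₂ K u v
      ; respect = λ w≋w′ (spans s∈ t∈ w≋) → spans s∈ t∈ (≋-trans (≋-sym w≋w′) w≋)
      }

    combinations-size : ∀ {u v N} → det u v ≉0 → HasSize (elements ⟨K⟩) N →
                        HasSize (elements (combinations u v)) (N ℕ.* N)
    combinations-size {u} {v} D≉0 |K| = transport-size
      {A = ×-setoid (elements ⟨K⟩) (elements ⟨K⟩)} {B = elements (combinations u v)}
      (λ ((s , s∈) , (t , t∈)) → s · u ⊕ t · v , spans s∈ t∈ ≋-refl)
      (coordinates-unique D≉0)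
      (λ (s≈ , t≈) i → +-cong (*-congʳ s≈) (*-congʳ t≈))
      (λ (w , spans s∈ t∈ w≋) → ((_ , s∈) , (_ , t∈)) , ≋-sym w≋)
      (×-size |K| |K|)

    multiples : V₂ → Subset (≋-setoid 2) L
    multiples w = record
      { member  = λ y → ∃[ x ] x ∈ₖ K × y ≋ x · w
      ; respect = λ y≋y′ (x , x∈ , y≋) → x , x∈ , ≋-trans (≋-sym y≋y′) y≋
      }

    multiples-size : ∀ {w N} → w ≉𝟘 → HasSize (elements ⟨K⟩) N → HasSize (elements (multiples w)) N
    multiples-size {w} w≉𝟘 = transport-size {A = elements ⟨K⟩} {B = elements (multiples w)}
      (λ (x , x∈) → x · w , x , x∈ , ≋-refl) (·-injective w≉𝟘) (λ x≈y i → *-congʳ x≈y)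
      (λ (y , x , x∈ , y≋) → (x , x∈) , ≋-sym y≋)

    module _ (𝔽q⊆K : ∀ {x} → x ∈ₖ 𝔽q → x ∈ₖ K) where

      combinations-isSubspace : ∀ u v → IsSubspace 𝔽q (combinations u v)
      combinations-isSubspace u v = record
        { 𝟘-closed = spans 0∈ 0∈ (λ i → solve 2 (λ u v → :0 := :0 :* u :+ :0 :* v) refl (u i) (v i))
        ; ⊕-closed = λ (spans {s} {t} s∈ t∈ w≋) (spans {s′} {t′} s′∈ t′∈ w′≋) →
            spans (+∈ s∈ s′∈) (+∈ t∈ t′∈) (λ i → trans (+-cong (w≋ i) (w′≋ i))
              (solve 6 (λ s t s′ t′ u v → (s :* u :+ t :* v) :+ (s′ :* u :+ t′ :* v) :=
                 (s :+ s′) :* u :+ (t :+ t′) :* v) refl s t s′ t′ (u i) (v i)))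
        ; ·-closed = λ x∈ → Span₂-scale K (𝔽q⊆K x∈)
        }

      multiples-isSubspace : ∀ w → IsSubspace 𝔽q (multiples w)
      multiples-isSubspace w = record
        { 𝟘-closed = 0# , 0∈ , λ i → sym (zeroˡ _)
        ; ⊕-closed = λ (x , x∈ , u≋) (y , y∈ , v≋) → x + y , +∈ x∈ y∈ ,
            λ i → trans (+-cong (u≋ i) (v≋ i)) (sym (distribʳ _ x y))
        ; ·-closed = λ {y} y∈ (x , x∈ , v≋) → y * x , *∈ (𝔽q⊆K y∈) x∈ ,
            λ i → trans (*-congˡ (v≋ i)) (sym (*-assoc y x _))
        }

  whole-size : HasSize (elements (Subfield.subset whole)) (q ℕ.^ n)
  whole-size = transport-size {A = setoid} {B = elements (Subfield.subset whole)}
    (λ x → x , _) (λ eq → eq) (λ eq → eq) (λ (x , _) → x , refl) |𝔽|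

  ≅Block-dimension : ∀ {w X} → w ≉𝟘 → X ≅ Block w → X is⟨ n -1⟩-dimensional
  ≅Block-dimension {w} {X} w≉𝟘 (≐⇒≅ (X⊆w , w⊆X)) = subspace⇒dimension 𝔽q |𝔽q| |𝔽| q>1 X (multiples whole w)
    (multiples-isSubspace whole _ w) (multiples-size whole w≉𝟘 whole-size)
    (λ P → mk⇔ (λ P∈X → let x , _ , P≋ = ∈Block⇒ P (X⊆w P P∈X) in x , _ , P≋)
               (λ (x , _ , P≋) → w⊆X P (⇒∈Block P P≋)))

  projectivization : ∀ (V : Subset (≋-setoid 2) L) → IsSubspace 𝔽q V → PointSet
  projectivization V V-sub = record
    { member  = λ P → proj₁ P ∈ V
    ; respect = λ {P} {Q} P≈Q P∈V →
        let x , x∈ , _ , Q≋xP = proportional-sym 𝔽q P≈Q in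
        respect V (≋-sym Q≋xP) (IsSubspace.·-closed V-sub x∈ P∈V)
    }

  module _ {u v : V₂} (D≉0 : det u v ≉0) where

    -- A line through ⟨a e⟩, ⟨b f⟩ and ⟨c (e + f)⟩ contains ⟨c e⟩ and ⟨c f⟩.
    Subline-isRegulus : IsRegulus n (Subline 𝔽q u v)
    Subline-isRegulus = (λ X (w , w≉𝟘 , _ , X≅w) → ≅Block-dimension w≉𝟘 X≅w) , transversal
      where
      transversal : ∀ l → IsLine l → ∀ A B C → A ∈ Subline 𝔽q u v → B ∈ Subline 𝔽q u v → C ∈ Subline 𝔽q u v →
        PairwiseDistinct A B C → Meets l A → Meets l B → Meets l C →
        ∀ X → X ∈ Subline 𝔽q u v → Meets l X
      transversal l l-line A B C A∈ B∈ C∈ distinct (P , P∈l , P∈A) (Q , Q∈l , Q∈B) (R , R∈l , R∈C) X X∈ =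
        let V , V-sub , |V| , l⇔V = dimension⇒subspace 𝔽q |𝔽q| |𝔽| l l-line
            a , a≉0 , P≋ = ∈Block⇒ P (proj₁ (≅⇒≐ A≅) P P∈A)
            b , b≉0 , Q≋ = ∈Block⇒ Q (proj₁ (≅⇒≐ B≅) Q Q∈B)
            c , c≉0 , R≋ = ∈Block⇒ R (proj₁ (≅⇒≐ C≅) R R∈C)
            P∈V = Equivalence.to (l⇔V P) P∈l
            Q∈V = Equivalence.to (l⇔V Q) Q∈l
            R∈V = Equivalence.to (l⇔V R) R∈l
            det-PQ : det (proj₁ P) (proj₁ Q) ≉0
            det-PQ = ≉0-resp (trans (det-scale a b e f) (det-cong (≋-sym P≋) (≋-sym Q≋)))
              (*-≉0 (*-≉0 a≉0 b≉0) independent)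
            x , y , x∈ , y∈ , R≋xP+yQ = exhaust-coordinates
              {A = Subfield.subset 𝔽q} {B = Subfield.subset 𝔽q} {V = V} |𝔽q| |𝔽q|
              (≡.subst (HasSize (elements V)) (≡.cong (q ℕ.*_) (ℕ.*-identityʳ q)) |V|)
              {u = proj₁ P} {v = proj₁ Q} det-PQ
              (λ x∈ y∈ → IsSubspace.⊕-closed V-sub
                (IsSubspace.·-closed V-sub x∈ P∈V) (IsSubspace.·-closed V-sub y∈ Q∈V))
              R∈V
            -- Comparing R = c (e + f) with x a e + y b f gives c = x a = y b, so c e = x P and c f
            -- = y Q.
            c≈xa , c≈yb = coordinates-unique independent {c} {c} {x * a} {y * b} λ i →
              trans (sym (distribˡ c (e i) (f i))) (trans (sym (R≋ i)) (trans (R≋xP+yQ i)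
                (+-cong (trans (*-congˡ (P≋ i)) (sym (*-assoc x a _)))
                        (trans (*-congˡ (Q≋ i)) (sym (*-assoc y b _))))))
            ce∈V = respect V (λ i → trans (*-congˡ (P≋ i)) (trans (sym (*-assoc x a _)) (*-congʳ (sym c≈xa))))
              (IsSubspace.·-closed V-sub x∈ P∈V)
            cf∈V = respect V (λ i → trans (*-congˡ (Q≋ i)) (trans (sym (*-assoc y b _)) (*-congʳ (sym c≈yb))))
              (IsSubspace.·-closed V-sub y∈ Q∈V)
            -- In the frame X = ⟨w⟩ with w = s e + t f and s, t in 𝔽q, so c w = s (c e) + t (c f)
            -- lies on the line.
            w , w≉𝟘 , (spans {s} {t} s∈ t∈ w≋) , X≅w = proj₁ same X X∈
            T = c · w , ·-≉𝟘 c≉0 w≉𝟘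
            cw∈V = respect V (λ i → trans
                (solve 5 (λ s t c e f → s :* (c :* e) :+ t :* (c :* f) := c :* (s :* e :+ t :* f))
                   refl s t c (e i) (f i))
                (*-congˡ (sym (w≋ i))))
              (IsSubspace.⊕-closed V-sub (IsSubspace.·-closed V-sub s∈ ce∈V) (IsSubspace.·-closed V-sub t∈ cf∈V))
        in T , Equivalence.from (l⇔V T) cw∈V , proj₂ (≅⇒≐ X≅w) T (⇒∈Block T {c} ≋-refl)
        where open Frame (frame 𝔽q A∈ B∈ C∈ distinct)

  -- Canonical representatives (1 , t) and (0 , 1) of the points of PG(1,q), so that directions can
  -- be compared as pairs.
  Normal : Carrier → Carrier → Set ℓ
  Normal s t = s ≈ 1# ⊎ (s ≈ 0# × t ≈ 1#)

  -- The entry 1 of a pair reads off the scalar; if the pairs are of different kinds, both scalars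
  -- turn out to be 0.
  normal-unique : ∀ {a b s t s′ t′} → Normal s t → Normal s′ t′ →
                  a * s ≈ b * s′ → a * t ≈ b * t′ → a ≈ b
  normal-unique {a} {b} (inj₁ s≈1) (inj₁ s′≈1) as≈ at≈ =
    trans (sym (trans (*-congˡ s≈1) (*-identityʳ a))) (trans as≈ (trans (*-congˡ s′≈1) (*-identityʳ b)))
  normal-unique {a} {b} {s} {t} (inj₁ s≈1) (inj₂ (s′≈0 , t′≈1)) as≈ at≈ = trans a≈0 (sym b≈0)
    where
    a≈0 : a ≈ 0#
    a≈0 = trans (sym (trans (*-congˡ s≈1) (*-identityʳ a))) (trans as≈ (trans (*-congˡ s′≈0) (zeroʳ b)))
    b≈0 : b ≈ 0#
    b≈0 = trans (sym (trans (*-congˡ t′≈1) (*-identityʳ b))) (trans (sym at≈) (trans (*-congʳ a≈0) (zeroˡ t)))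
  normal-unique {a} {b} {s} {t} {s′} {t′} (inj₂ (s≈0 , t≈1)) (inj₁ s′≈1) as≈ at≈ = trans a≈0 (sym b≈0)
    where
    b≈0 : b ≈ 0#
    b≈0 = trans (sym (trans (*-congˡ s′≈1) (*-identityʳ b))) (trans (sym as≈) (trans (*-congˡ s≈0) (zeroʳ a)))
    a≈0 : a ≈ 0#
    a≈0 = trans (sym (trans (*-congˡ t≈1) (*-identityʳ a))) (trans at≈ (trans (*-congʳ b≈0) (zeroˡ t′)))
  normal-unique {a} {b} (inj₂ (_ , t≈1)) (inj₂ (_ , t′≈1)) as≈ at≈ =
    trans (sym (trans (*-congˡ t≈1) (*-identityʳ a))) (trans at≈ (trans (*-congˡ t′≈1) (*-identityʳ b)))

  normal-parallel : ∀ {s t s′ t′} → Normal s t → Normal s′ t′ → s * t′ - t * s′ ≈ 0# → s ≈ s′ × t ≈ t′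
  normal-parallel {s} {t} {s′} {t′} (inj₁ s≈1) (inj₁ s′≈1) D≈0 = trans s≈1 (sym s′≈1) ,
    sym (x-y≈0⇒x≈y (trans (+-cong (sym (trans (*-congʳ s≈1) (*-identityˡ t′)))
      (-‿cong (sym (trans (*-congˡ s′≈1) (*-identityʳ t))))) D≈0))
  normal-parallel {s} {t} {s′} {t′} (inj₁ s≈1) (inj₂ (s′≈0 , t′≈1)) D≈0 = contradiction
    (trans (trans (solve 1 (λ t → :1 := :1 :* :1 :- t :* :0) refl t)
      (+-cong (*-cong (sym s≈1) (sym t′≈1)) (-‿cong (*-congˡ (sym s′≈0))))) D≈0) 1≉0
  normal-parallel {s} {t} {s′} {t′} (inj₂ (s≈0 , t≈1)) (inj₁ s′≈1) D≈0 = contradiction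
    (trans (trans (solve 1 (λ t′ → :1 := :- (:0 :* t′ :- :1 :* :1)) refl t′)
      (-‿cong (+-cong (*-congʳ (sym s≈0)) (-‿cong (*-cong (sym t≈1) (sym s′≈1))))))
      (trans (-‿cong D≈0) (solve 0 (:- :0 := :0) refl))) 1≉0
  normal-parallel (inj₂ (s≈0 , t≈1)) (inj₂ (s′≈0 , t′≈1)) D≈0 =
    trans s≈0 (sym s′≈0) , trans t≈1 (sym t′≈1)

  normal-≉0 : ∀ {s t} → Normal s t → ¬ (s ≈ 0# × t ≈ 0#)
  normal-≉0 (inj₁ s≈1)       (s≈0 , _) = 1≉0 (trans (sym s≈1) s≈0)
  normal-≉0 (inj₂ (_ , t≈1)) (_ , t≈0) = 1≉0 (trans (sym t≈1) t≈0)

  -- A space of the dimension of a regulus element that meets every transversal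
  -- { x a u + y a v } does so in one point each, and that point has the same
  -- direction (s , t) for all a.
  module _ {u v : V₂} (D≉0 : det u v ≉0) {V : Subset (≋-setoid 2) L} (V-sub : IsSubspace 𝔽q V)
           (|V| : HasSize (elements V) (q ℕ.^ n)) where

    open IsSubspace V-sub

    dir : Carrier → Carrier → V₂
    dir s t = s · u ⊕ t · v

    record Direction (a : Carrier) : Set L where
      field
        {s t} : Carrier
        s∈K : s ∈ₖ 𝔽q
        t∈K : t ∈ₖ 𝔽q
        normal : Normal s t
        a·dir∈V : a · dir s t ∈ V

    module _ (direction : ∀ a → Direction a) where

      open Direction

      private
        -- Directions are chosen at canonical representatives, so that σ and τ respect ≈.
        rep : Carrier → Carrier
        rep a = enum |𝔽| (index |𝔽| a)

        δ : ∀ a → Direction (rep a)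
        δ a = direction (rep a)

        σ τ : Carrier → Carrier
        σ a = s (δ a)
        τ a = t (δ a)

        σ-cong : ∀ {a b} → a ≈ b → σ a ≈ σ b
        σ-cong a≈b = reflexive (≡.cong (λ i → s (direction (enum |𝔽| i))) (index-cong |𝔽| a≈b))
        τ-cong : ∀ {a b} → a ≈ b → τ a ≈ τ b
        τ-cong a≈b = reflexive (≡.cong (λ i → t (direction (enum |𝔽| i))) (index-cong |𝔽| a≈b))

        chosen : Carrier → V₂
        chosen a = a · dir (σ a) (τ a)

        chosen∈V : ∀ a → chosen a ∈ V
        chosen∈V a = respect V (λ i → *-congʳ (enum-index |𝔽| a)) (a·dir∈V (δ a))

        coordinates : ∀ {a b s t s′ t′} → a · dir s t ≋ b · dir s′ t′ → a * s ≈ b * s′ × a * t ≈ b * t′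
        coordinates {a} {b} {s} {t} {s′} {t′} eq = coordinates-unique D≉0 {a * s} {a * t} {b * s′} {b * t′} λ i →
          trans (expand a s t i) (trans (eq i) (sym (expand b s′ t′ i)))
          where
          expand : ∀ a s t → (a * s) · u ⊕ (a * t) · v ≋ a · dir s t
          expand a s t i = solve 5 (λ a s t u v → (a :* s) :* u :+ (a :* t) :* v := a :* (s :* u :+ t :* v))
            refl a s t (u i) (v i)

        -- By `normal-unique` the chosen vectors of distinct scalars are distinct, and there are q^n
        -- of them, as many as vectors in V.
        exhausted : ∀ {w} → w ∈ V → ∃[ a ] chosen a ≋ w
        exhausted {w} w∈V = injective⇒surjective {A = setoid} {B = elements V}
          (λ a → chosen a , chosen∈V a)
          (λ {a} {b} eq → let eq₁ , eq₂ = coordinates {a} {b} {σ a} {τ a} {σ b} {τ b} eq in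
            normal-unique (normal (δ a)) (normal (δ b)) eq₁ eq₂)
          |𝔽| |V| (w , w∈V)

        -- A vector of V on the transversal of a is the chosen vector of some b, and `normal-unique`
        -- forces b = a.
        direction-unique : ∀ {a s t} → a ≉0 → Normal s t → a · dir s t ∈ V → s ≈ σ a × t ≈ τ a
        direction-unique {a} {s} {t} a≉0 st-normal ast∈V =
          let b , eq = exhausted ast∈V
              eq₁ , eq₂ = coordinates {b} {a} {σ b} {τ b} {s} {t} eq
              b≈a = normal-unique (normal (δ b)) st-normal eq₁ eq₂
          in *-cancelˡ-≉0 a≉0 (trans (sym eq₁) (*-cong b≈a (σ-cong b≈a))) ,
             *-cancelˡ-≉0 a≉0 (trans (sym eq₂) (*-cong b≈a (τ-cong b≈a)))

        -- V is additive, so `chosen a ⊕ chosen b` is `chosen e` for some e. Let D be the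
        -- determinant of the directions of a and b, and x that of e and b. Then a D = e x. If D
        -- were nonzero, e would be a multiple of a by a factor in 𝔽q, hence share its direction,
        -- and the sum would leave b D = 0.
        constant : ∀ {a b} → a ≉0 → b ≉0 → σ a ≈ σ b × τ a ≈ τ b
        constant {a} {b} a≉0 b≉0 = normal-parallel (normal (δ a)) (normal (δ b))
          (decidable-stable (D ≟ 0#) λ D≉0′ → D≉0′ (xy≈0⇒y≈0 b≉0 (bD≈0 D≉0′)))
          where
          D : Carrier
          D = σ a * τ b - τ a * σ b
          E : ∃[ e ] chosen e ≋ chosen a ⊕ chosen b
          E = exhausted (⊕-closed (chosen∈V a) (chosen∈V b))
          e x : Carrier
          e = proj₁ E
          x = σ e * τ b - τ e * σ b
          E-coordinates : e * σ e ≈ a * σ a + b * σ b × e * τ e ≈ a * τ a + b * τ b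
          E-coordinates = coordinates-unique D≉0 {e * σ e} {e * τ e} {a * σ a + b * σ b} {a * τ a + b * τ b} λ i →
            trans (solve 5 (λ a s t u v → (a :* s) :* u :+ (a :* t) :* v := a :* (s :* u :+ t :* v))
                     refl e (σ e) (τ e) (u i) (v i))
            (trans (proj₂ E i)
            (solve 8 (λ a s t b s′ t′ u v → a :* (s :* u :+ t :* v) :+ b :* (s′ :* u :+ t′ :* v) :=
              (a :* s :+ b :* s′) :* u :+ (a :* t :+ b :* t′) :* v) refl a (σ a) (τ a) b (σ b) (τ b) (u i) (v i)))
          aD≈ex : a * D ≈ e * x
          aD≈ex = modulo₂ (- τ b) (σ b) (proj₁ E-coordinates) (proj₂ E-coordinates)
            (solve 9 (λ a s t b s′ t′ e s″ t″ → a :* (s :* t′ :- t :* s′) :- e :* (s″ :* t′ :- t″ :* s′) :=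
              (:- t′) :* (e :* s″ :- (a :* s :+ b :* s′)) :+ s′ :* (e :* t″ :- (a :* t :+ b :* t′))) refl
              a (σ a) (τ a) b (σ b) (τ b) e (σ e) (τ e))
          x∈K : x ∈ₖ 𝔽q
          x∈K = minor-closed 𝔽q (s∈K (δ e)) (t∈K (δ b)) (t∈K (δ e)) (s∈K (δ b))
          D∈K : D ∈ₖ 𝔽q
          D∈K = minor-closed 𝔽q (s∈K (δ a)) (t∈K (δ b)) (t∈K (δ a)) (s∈K (δ b))
          bD≈0 : D ≉0 → b * D ≈ 0#
          bD≈0 D≉0′ = modulo₂ (- τ a) (σ a)
              (trans (sym (proj₁ E-coordinates)) (*-congˡ (sym (proj₁ same-direction))))
              (trans (sym (proj₂ E-coordinates)) (*-congˡ (sym (proj₂ same-direction))))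
              (solve 7 (λ a s t b s′ t′ e → b :* (s :* t′ :- t :* s′) :- :0 :=
                (:- t) :* ((a :* s :+ b :* s′) :- e :* s) :+ s :* ((a :* t :+ b :* t′) :- e :* t)) refl
                a (σ a) (τ a) b (σ b) (τ b) e)
            where
            ex≉0 : e * x ≉0
            ex≉0 = ≉0-resp aD≈ex (*-≉0 a≉0 D≉0′)
            x≉0 : x ≉0
            x≉0 = ≉0ʳ ex≉0
            same-direction : σ a ≈ σ e × τ a ≈ τ e
            same-direction = direction-unique (≉0ˡ ex≉0) (normal (δ a))
              (respect V (λ i → modulo₂ (e * dir (σ a) (τ a) i) (x ⁻¹ * dir (σ a) (τ a) i) (x*x⁻¹≈1 x≉0) aD≈ex
                (solve 6 (λ x j D a e w → (D :* j) :* (a :* w) :- e :* w :=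
                  (e :* w) :* (x :* j :- :1) :+ (j :* w) :* (a :* D :- e :* x)) refl
                  x (x ⁻¹) D a e (dir (σ a) (τ a) i)))
                (·-closed (*-closed D∈K (⁻¹-closed 𝔽q x≉0 x∈K)) (chosen∈V a)))

      -- The common direction is read off at `1#`; the 𝔽-multiples of its vector lie in V and are as
      -- many as V has elements.
      V≐multiples : Σ[ w ∈ V₂ ] w ≉𝟘 × Span₂ 𝔽q u v w × V ≐ multiples whole w
      V≐multiples = w , w≉𝟘 , spans (s∈K (δ 1#)) (t∈K (δ 1#)) ≋-refl ,
        ⊆-size⇒⊇ {A = ≋-setoid 2} {X = multiples whole w} (multiples-size whole w≉𝟘 whole-size)
          {Y = V} |V| multiples⊆V , multiples⊆V
        where
        w : V₂
        w = dir (σ 1#) (τ 1#)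
        w≉𝟘 : w ≉𝟘
        w≉𝟘 = combination-≉𝟘 D≉0 (normal-≉0 (normal (δ 1#)))
        multiples⊆V : multiples whole w ⊆ V
        multiples⊆V y (a , _ , y≋) = case a ≟ 0# of λ
          { (yes a≈0) → respect V (λ i → sym (trans (y≋ i) (trans (*-congʳ a≈0) (zeroˡ _)))) 𝟘-closed
          ; (no a≉0)  → let σ≈ , τ≈ = constant a≉0 1≉0 in
              respect V (λ i → trans (*-congˡ (+-cong (*-congʳ σ≈) (*-congʳ τ≈))) (sym (y≋ i))) (chosen∈V a)
          }

  module _ {u v : V₂} (D≉0 : det u v ≉0) {A B C : PointSet}
           (A≅ : A ≅ Block u) (B≅ : B ≅ Block v) (C≅ : C ≅ Block (u ⊕ v)) where

    -- Every ⟨a u⟩, ⟨a v⟩ spans a transversal of A, B and C.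
    regulus⊆Subline : PairwiseDistinct A B C → ∀ R → IsRegulusThrough q n A B C R → R ⊆ Subline 𝔽q u v
    regulus⊆Subline distinct R ((dim , transversal) , |R| , A∈R , B∈R , C∈R) X X∈R =
      let w , w≉𝟘 , w∈ , V⊆w , w⊆V = V≐multiples D≉0 V-sub |V| direction in
      w , w≉𝟘 , w∈ , ≐⇒≅
        ( (λ P P∈X → let x , _ , P≋ = V⊆w _ (Equivalence.to (X⇔V P) P∈X) in ⇒∈Block P P≋)
        , (λ P P∈w → let x , _ , P≋ = ∈Block⇒ P P∈w in Equivalence.from (X⇔V P) (w⊆V _ (x , _ , P≋))))
      where
      X-subspace : Σ[ V ∈ Subset (≋-setoid 2) L ] IsSubspace 𝔽q V ×
          HasSize (elements V) (q ℕ.^ n) × IsProjectivization 𝔽q |𝔽q| |𝔽| X V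
      X-subspace = dimension⇒subspace 𝔽q |𝔽q| |𝔽| X (dim X X∈R)
      V : Subset (≋-setoid 2) L
      V = proj₁ X-subspace
      V-sub : IsSubspace 𝔽q V
      V-sub = proj₁ (proj₂ X-subspace)
      |V| : HasSize (elements V) (q ℕ.^ n)
      |V| = proj₁ (proj₂ (proj₂ X-subspace))
      X⇔V : IsProjectivization 𝔽q |𝔽q| |𝔽| X V
      X⇔V = proj₂ (proj₂ (proj₂ X-subspace))
      open IsSubspace V-sub
      module _ {a : Carrier} (a≉0 : a ≉0) where
        l : PointSet
        l = projectivization (combinations 𝔽q (a · u) (a · v))
          (combinations-isSubspace 𝔽q (λ x∈ → x∈) (a · u) (a · v))
        l-line : IsLine l
        l-line = subspace⇒dimension 𝔽q |𝔽q| |𝔽| q>1 l (combinations 𝔽q (a · u) (a · v))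
          (combinations-isSubspace 𝔽q (λ x∈ → x∈) (a · u) (a · v))
          (≡.subst (HasSize (elements (combinations 𝔽q (a · u) (a · v)))) (≡.cong (q ℕ.*_) (≡.sym (ℕ.*-identityʳ q)))
            (combinations-size 𝔽q (≉0-resp (det-scale a a u v) (*-≉0 (*-≉0 a≉0 a≉0) D≉0)) |𝔽q|))
          (λ P → mk⇔ (λ P∈l → P∈l) (λ P∈ → P∈))
        meets : ∀ {Y w} (w≉𝟘 : w ≉𝟘) → Y ≅ Block w → Span₂ 𝔽q (a · u) (a · v) (a · w) → Meets l Y
        meets {Y} {w} w≉𝟘 Y≅w aw∈ = let P = a · w , ·-≉𝟘 a≉0 w≉𝟘 in
          P , aw∈ , proj₂ (≅⇒≐ Y≅w) P (⇒∈Block P {a} ≋-refl)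
        meets-X : Meets l X
        meets-X = transversal l l-line A B C A∈R B∈R C∈R distinct
          (meets {A} (u≉𝟘 {u} {v} D≉0) A≅ (spans 1-closed 0-closed λ i →
            solve 2 (λ u v → u := :1 :* u :+ :0 :* v) refl (a * u i) (a * v i)))
          (meets {B} (v≉𝟘 {u} {v} D≉0) B≅ (spans 0-closed 1-closed λ i →
            solve 2 (λ u v → v := :0 :* u :+ :1 :* v) refl (a * u i) (a * v i)))
          (meets {C} u⊕v≉𝟘 C≅ (spans 1-closed 1-closed λ i →
            solve 3 (λ a u v → a :* (u :+ v) := :1 :* (a :* u) :+ :1 :* (a :* v)) refl a (u i) (v i)))
          X X∈R
          where
          u⊕v≉𝟘 : u ⊕ v ≉𝟘
          u⊕v≉𝟘 eq = combination-≉𝟘 D≉0 {1#} {1#} (λ (1≈0 , _) → 1≉0 1≈0) λ i →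
            trans (+-cong (*-identityˡ _) (*-identityˡ _)) (eq i)
        direction-≉0 : Direction D≉0 V-sub |V| a
        direction-≉0 =
          let P , (spans {s} {t} s∈ t∈ P≋) , P∈X = meets-X
              P∈V = Equivalence.to (X⇔V P) P∈X
          -- Dividing by s, or by t when s = 0, makes the pair normal. The factor is in 𝔽q, so the
          -- vector stays in V.
          in case s ≟ 0# of λ
            { (yes s≈0) →
                let P≋t·av : proj₁ P ≋ t · a · v
                    P≋t·av i = trans (P≋ i) (trans (+-congʳ (trans (*-congʳ s≈0) (zeroˡ _))) (+-identityˡ _))
                    t≉0 : t ≉0
                    t≉0 = ≉𝟘⇒≉0 {w = a · v} (proj₂ P) P≋t·av
                in record { s∈K = 0-closed ; t∈K = 1-closed ; normal = inj₂ (refl , refl)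
                  ; a·dir∈V = respect V (λ i → modulo₂ (a * v i) (t ⁻¹) (x*x⁻¹≈1 t≉0) (P≋t·av i)
                      (solve 6 (λ t j a u v p → j :* p :- a :* (:0 :* u :+ :1 :* v) :=
                         (a :* v) :* (t :* j :- :1) :+ j :* (p :- t :* (a :* v)))
                         refl t (t ⁻¹) a (u i) (v i) (proj₁ P i)))
                      (·-closed (⁻¹-closed 𝔽q t≉0 t∈) P∈V) }
            ; (no s≉0) → record { s∈K = 1-closed ; t∈K = *-closed t∈ (⁻¹-closed 𝔽q s≉0 s∈) ; normal = inj₁ refl
                  ; a·dir∈V = respect V (λ i → modulo₂ (a * u i) (s ⁻¹) (x*x⁻¹≈1 s≉0) (P≋ i)
                      (solve 7 (λ s t j a u v p → j :* p :- a :* (:1 :* u :+ (t :* j) :* v) :=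
                         (a :* u) :* (s :* j :- :1) :+ j :* (p :- (s :* (a :* u) :+ t :* (a :* v)))) refl
                           s t (s ⁻¹) a (u i) (v i) (proj₁ P i)))
                      (·-closed (⁻¹-closed 𝔽q s≉0 s∈) P∈V) }
            }
      direction : ∀ a → Direction D≉0 V-sub |V| a
      direction a = case a ≟ 0# of λ
        -- The transversal degenerates at a = 0, where any normal pair will do because 𝟘 lies in V.
        { (yes a≈0) → record { s∈K = 0-closed ; t∈K = 1-closed ; normal = inj₂ (refl , refl)
            ; a·dir∈V = respect V (λ i → sym (trans (*-congʳ a≈0) (zeroˡ _))) 𝟘-closed }
        ; (no a≉0) → direction-≉0 a≉0
        }

    Subline-isRegulusThrough : IsRegulusThrough q n A B C (Subline 𝔽q u v)
    Subline-isRegulusThrough = Subline-isRegulus D≉0 ,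
      ≡.subst (HasSize (elements (Subline 𝔽q u v))) (ℕ.+-comm 1 q) (Subline-size D≉0 𝔽q |𝔽q|) ,
      (u , u≉𝟘 {u} {v} D≉0 , spans 1-closed 0-closed
        (λ i → solve 2 (λ u v → u := :1 :* u :+ :0 :* v) refl (u i) (v i)) , A≅) ,
      (v , v≉𝟘 {u} {v} D≉0 , spans 0-closed 1-closed
        (λ i → solve 2 (λ u v → v := :0 :* u :+ :1 :* v) refl (u i) (v i)) , B≅) ,
      (1# · u ⊕ 1# · v , combination-≉𝟘 D≉0 (λ (1≈0 , _) → 1≉0 1≈0) , spans 1-closed 1-closed ≋-refl ,
        ≅-trans C≅ (≋⇒Block-≅ λ i → solve 2 (λ u v → u :+ v := :1 :* u :+ :1 :* v) refl (u i) (v i)))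

    abstract
      -- R lies in the subline, and both have q + 1 elements.
      unique-regulus : PairwiseDistinct A B C → ∀ {R} → IsRegulusThrough q n A B C R → Subline 𝔽q u v ≐ R
      unique-regulus distinct {R} R-reg@(_ , |R| , _) =
        ⊆-size⇒⊇ {X = R} |R| {Y = Subline 𝔽q u v} (proj₁ (proj₂ Subline-isRegulusThrough)) R⊆ , R⊆
        where
        R⊆ : R ⊆ Subline 𝔽q u v
        R⊆ = regulus⊆Subline distinct R R-reg

-- Hua's identity: from additive closure to multiplicative closure.

module Hua {c ℓ} (𝔽 : Field c ℓ) (_≟_ : Decidable (Field._≈_ 𝔽)) where

  open Field 𝔽 hiding (zero)
  open FieldProperties 𝔽 _≟_

  record IsAdditive {p} (T : Subset setoid p) : Set (c ⊔ ℓ ⊔ p) where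
    field
      0∈ : 0# ∈ T
      +-closed : ∀ {x y} → x ∈ T → y ∈ T → x + y ∈ T
      neg-closed : ∀ {x} → x ∈ T → - x ∈ T

  ⁻¹-unique : ∀ {x y} → x * y ≈ 1# → y ≈ x ⁻¹
  ⁻¹-unique {x} {y} xy≈1 = *-cancelˡ-≉0 x≉0 (trans xy≈1 (sym (x*x⁻¹≈1 x≉0)))
    where
    x≉0 : x ≉0
    x≉0 = ≉0ˡ (≉0-resp (sym xy≈1) 1≉0)

  modulo₃ : ∀ {a b a′ b′ a″ b″} s s′ s″ {x y} → a ≈ b → a′ ≈ b′ → a″ ≈ b″ →
            x - y ≈ s * (a - b) + s′ * (a′ - b′) + s″ * (a″ - b″) → x ≈ y
  modulo₃ s s′ s″ a≈b a′≈b′ a″≈b″ eq = modulo₂ s s′ a≈b a′≈b′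
    (trans eq (trans (+-congˡ (trans (*-congˡ (x≈y⇒x-y≈0 a″≈b″)) (zeroʳ s″))) (+-identityʳ _)))

  module _ {p} {T T′ : Subset setoid p} (T-add : IsAdditive T) (T′-add : IsAdditive T′)
           (1∈T : 1# ∈ T) (1∈T′ : 1# ∈ T′)
           (T⁻¹⊆T′ : ∀ {x} → x ∈ T → x ≉0 → x ⁻¹ ∈ T′)
           (T′⁻¹⊆T : ∀ {x} → x ∈ T′ → x ≉0 → x ⁻¹ ∈ T) where

    open IsAdditive T-add

    -- 1 - (1 + (z - 1)⁻¹)⁻¹ = z⁻¹
    reciprocal-closed : ∀ {z} → z ∈ T → z ≉0 → z ⁻¹ ∈ T
    reciprocal-closed {z} z∈T z≉0 with (z - 1#) ≟ 0#
    ... | yes z-1≈0 = respect T (⁻¹-unique (trans (*-identityʳ z) (x-y≈0⇒x≈y z-1≈0))) 1∈T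
    ... | no z-1≉0 = respect T (⁻¹-unique (modulo₂ j (- (z - 1#)) (x*x⁻¹≈1 z-1≉0) (x*x⁻¹≈1 1+i≉0)
        (solve 3 (λ z i j → z :* (:1 :- j) :- :1 :=
          j :* ((z :- :1) :* i :- :1) :+ (:- (z :- :1)) :* ((:1 :+ i) :* j :- :1)) refl z i j)))
        (+-closed 1∈T (neg-closed (T′⁻¹⊆T 1+i∈T′ 1+i≉0)))
      where
      i j : Carrier
      i = (z - 1#) ⁻¹
      j = (1# + i) ⁻¹
      -- The inner inverse leads from T to T′, where 1 is added; the outer inverse leads back to T.
      1+i∈T′ : 1# + i ∈ T′
      1+i∈T′ = IsAdditive.+-closed T′-add 1∈T′ (T⁻¹⊆T′ (+-closed z∈T (neg-closed 1∈T)) z-1≉0)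
      1+i≉0 : 1# + i ≉0
      1+i≉0 = ≉0ʳ {z - 1#} (≉0-resp (sym (modulo 1# (x*x⁻¹≈1 z-1≉0)
        (solve 2 (λ z i → (z :- :1) :* (:1 :+ i) :- z := :1 :* ((z :- :1) :* i :- :1)) refl z i))) z≉0)

    -- Hua's identity a - (a⁻¹ + (b⁻¹ - a)⁻¹)⁻¹ = a²b.
    aab-closed : ∀ {a b} → a ∈ T → b ∈ T → a * a * b ∈ T
    aab-closed {a} {b} a∈T b∈T with a ≟ 0# | b ≟ 0#
    ... | yes a≈0 | _ = respect T (sym (trans (*-congʳ (trans (*-congʳ a≈0) (zeroˡ a))) (zeroˡ b))) 0∈
    ... | no _ | yes b≈0 = respect T (sym (trans (*-congˡ b≈0) (zeroʳ _))) 0∈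
    ... | no a≉0 | no b≉0 with (b ⁻¹ - a) ≟ 0#
    -- Here b⁻¹ = a, so a²b is a itself.
    ...   | yes B-a≈0 = respect T (modulo₂ (- a) (a * b) (x*x⁻¹≈1 b≉0) (x-y≈0⇒x≈y B-a≈0)
            (solve 3 (λ a b B → a :- a :* a :* b := (:- a) :* (b :* B :- :1) :+ (a :* b) :* (B :- a))
              refl a b (b ⁻¹))) a∈T
    ...   | no B-a≉0 = respect T (trans (+-congˡ (-‿cong (sym (⁻¹-unique d*≈1))))
              (solve 2 (λ a b → a :- (a :- a :* a :* b) := a :* a :* b) refl a b))
            (+-closed a∈T (neg-closed (reciprocal-closed
              (+-closed (reciprocal-closed a∈T a≉0)
                (reciprocal-closed (+-closed (reciprocal-closed b∈T b≉0) (neg-closed a∈T)) B-a≉0))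
              (≉0ˡ (≉0-resp (sym d*≈1) 1≉0)))))
      where
      -- This makes a - a²b the inverse of the first factor, and shows that this factor is nonzero.
      d*≈1 : (a ⁻¹ + (b ⁻¹ - a) ⁻¹) * (a - a * a * b) ≈ 1#
      d*≈1 = modulo₃ (1# - a * b) (a * b) (- ((b ⁻¹ - a) ⁻¹ * a)) (x*x⁻¹≈1 a≉0) (x*x⁻¹≈1 B-a≉0) (x*x⁻¹≈1 b≉0)
        (solve 5 (λ a b A B C → (A :+ C) :* (a :- a :* a :* b) :- :1 :=
          (:1 :- a :* b) :* (a :* A :- :1) :+ (a :* b) :* ((B :- a) :* C :- :1) :+
          (:- (C :* a)) :* (b :* B :- :1)) refl a b (a ⁻¹) (b ⁻¹) ((b ⁻¹ - a) ⁻¹))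

    -- In odd characteristic ab is half of (a + 1)²b - a²b - b, and T is closed
    -- under halving since x/2 = (x⁻¹ + x⁻¹)⁻¹. In characteristic 2 every
    -- element of the finite set T is a square c² with c in T.
    *-closed : ∀ {N} → HasSize (elements T) N → ∀ {a b} → a ∈ T → b ∈ T → a * b ∈ T
    *-closed |T| {a} {b} a∈T b∈T with (1# + 1#) ≟ 0#
    ... | yes 2≈0 =
      let (c , c∈T) , cc≈a = injective⇒surjective {A = elements T} {B = elements T}
            (λ (x , x∈T) → x * x * 1# , aab-closed x∈T 1∈T) square-injective |T| |T| (a , a∈T)
      in respect T (*-congʳ (trans (sym (*-identityʳ _)) cc≈a)) (aab-closed c∈T b∈T)
      where
      square-injective : ∀ {x y} → x * x * 1# ≈ y * y * 1# → x ≈ y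
      square-injective {x} {y} eq with (x - y) ≟ 0#
      ... | yes x-y≈0 = x-y≈0⇒x≈y x-y≈0
      -- In characteristic 2, (x - y)² = x² - y² = 0.
      ... | no x-y≉0 = contradiction (xy≈0⇒y≈0 x-y≉0 (modulo₂ 1# (y * y - x * y) eq 2≈0
        (solve 2 (λ x y → (x :- y) :* (x :- y) :- :0 :=
          :1 :* (x :* x :* :1 :- y :* y :* :1) :+ (y :* y :- x :* y) :* ((:1 :+ :1) :- :0)) refl x y))) x-y≉0
    ... | no 2≉0 with (a * b + a * b) ≟ 0#
    ...   | yes 2ab≈0 = respect T (sym (xy≈0⇒y≈0 2≉0 (trans
              (solve 1 (λ y → (:1 :+ :1) :* y := y :+ y) refl (a * b)) 2ab≈0))) 0∈
    ...   | no 2ab≉0 = respect T (sym (⁻¹-unique half))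
            (reciprocal-closed (+-closed i∈T i∈T) (≉0ˡ (≉0-resp (sym half) 1≉0)))
      where
      2ab∈T : a * b + a * b ∈ T
      2ab∈T = respect T
        (solve 2 (λ a b → (a :+ :1) :* (a :+ :1) :* b :- a :* a :* b :- b := a :* b :+ a :* b) refl a b)
        (+-closed (+-closed (aab-closed (+-closed a∈T 1∈T) b∈T) (neg-closed (aab-closed a∈T b∈T))) (neg-closed b∈T))
      i : Carrier
      i = (a * b + a * b) ⁻¹
      i∈T : i ∈ T
      i∈T = reciprocal-closed 2ab∈T 2ab≉0
      half : (i + i) * (a * b) ≈ 1#
      half = trans (solve 2 (λ i y → (i :+ i) :* y := (y :+ y) :* i) refl i (a * b)) (x*x⁻¹≈1 2ab≉0)

-- The four conditions and their passage through sublines in coordinates.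

module Conditions {c ℓ} (𝔽 : Field c ℓ) (_≟_ : Decidable (Field._≈_ 𝔽)) (𝔽q 𝔽qᵏ : Subfield 𝔽)
  {q n k : ℕ} (q>2 : q ℕ.> 2) (k≥1 : k ℕ.≥ 1)
  (|𝔽| : HasSize (Field.setoid 𝔽) (q ℕ.^ n))
  (|𝔽q| : HasSize (elements (Subfield.subset 𝔽q)) q)
  (|𝔽qᵏ| : HasSize (elements (Subfield.subset 𝔽qᵏ)) (q ℕ.^ k)) where

  q>1 : q ℕ.> 1
  q>1 = ℕ.<⇒≤ q>2

  open Field 𝔽 hiding (zero)
  open Geometry 𝔽
  open FieldProperties 𝔽 _≟_
  open LinearAlgebra 𝔽 _≟_
  open Plane 𝔽 _≟_ 𝔽q
  open Reguli 𝔽 _≟_ 𝔽q {q} {n} q>1 |𝔽| |𝔽q|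
  open Hua 𝔽 _≟_
  open VectorEquality setoid using (_≋_; ≋-setoid; ≋-refl; ≋-sym)
  open H∞ 𝔽q
  private
    module K = Subfield 𝔽q
    module Kᵏ = Subfield 𝔽qᵏ
    L = c ⊔ ℓ
    V₂ = Vector Carrier 2

  qᵏ>1 : q ℕ.^ k ℕ.> 1
  qᵏ>1 = ℕ.^-monoʳ-< q q>1 k≥1

  -- Elements of 𝔽q are fixed by x ↦ x^q, hence by its k-th iterate, and the fixed points of the
  -- latter all lie in 𝔽qᵏ.
  𝔽q⊆𝔽qᵏ : ∀ {x} → x ∈ₖ 𝔽q → x ∈ₖ 𝔽qᵏ
  𝔽q⊆𝔽qᵏ x∈ = x^N≈x⇒x∈T {T = Kᵏ.subset} Kᵏ.0-closed Kᵏ.*-closed |𝔽qᵏ| qᵏ>1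
    (^-fixed q (fermat {T = K.subset} K.0-closed K.*-closed |𝔽q| x∈) k)

  multiplicative⇒𝔽qᵏ : ∀ {p} {T : Subset setoid p} → HasSize (elements T) (q ℕ.^ k) → 0# ∈ T →
    (∀ {x y} → x ∈ T → y ∈ T → x * y ∈ T) → T ≐ Kᵏ.subset
  multiplicative⇒𝔽qᵏ {T = T} |T| 0∈T *-closed = T⊆ , ⊆-size⇒⊇ {X = T} |T| {Y = Kᵏ.subset} |𝔽qᵏ| T⊆
    where
    T⊆ : T ⊆ Kᵏ.subset
    T⊆ x x∈T = x^N≈x⇒x∈T {T = Kᵏ.subset} Kᵏ.0-closed Kᵏ.*-closed |𝔽qᵏ| qᵏ>1
      (fermat {T = T} 0∈T *-closed |T| x∈T)

  Subline-mono : ∀ {u v} → Subline 𝔽q u v ⊆ Subline 𝔽qᵏ u v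
  Subline-mono X (w , w≉𝟘 , spans s∈ t∈ w≋ , X≅w) = w , w≉𝟘 , spans (𝔽q⊆𝔽qᵏ s∈) (𝔽q⊆𝔽qᵏ t∈) w≋ , X≅w

  nonzero-element : ∀ {p M} {X : Subset setoid p} → HasSize (elements X) M → M ℕ.> 1 → ∃[ x ] x ∈ X × x ≉0
  nonzero-element {X = X} |X| (s≤s (s≤s _)) = case proj₁ (enum |X| 0F) ≟ 0# of λ
    { (no x≉0)  → proj₁ (enum |X| 0F) , proj₂ (enum |X| 0F) , x≉0
    ; (yes x≈0) → proj₁ (enum |X| 1F) , proj₂ (enum |X| 1F) ,
        λ y≈0 → case enum-injective |X| {0F} {1F} (trans x≈0 (sym y≈0)) of λ ()
    }

  module _ (S : Subset pointSets L) where

    condition₁ condition₂ condition₃ condition₄ : Set (Level.suc L)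
    condition₁ = Σ[ m ∈ Subset PG₂ L ] IsSubline 𝔽qᵏ m × m ⊆ l∞ × S ≐ φ[ m ]
    condition₂ = ∀ A B C → A ∈ S → B ∈ S → C ∈ S → PairwiseDistinct A B C →
      Σ[ R! ∈ ∃! _≐_ (IsRegulusThrough q n A B C) ] proj₁ R! ⊆ S
    condition₃ = Σ[ W ∈ PointSet ] W is⟨ 2 ℕ.* k -1⟩-dimensional ×
      (∀ X → X ∈ S → W ∩ X is⟨ k -1⟩-dimensional)
    condition₄ = Σ[ W ∈ PointSet ] W is⟨ 2 ℕ.* k -1⟩-dimensional ×
      (∀ X → X ∈ S → W ∩ X is⟨ k -1⟩-dimensional × W ∩ X ∈ spread 𝔽qᵏ)

    -- The first condition in coordinates of 𝔽², without the ambient PG(2,𝔽).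
    IsSublineImage : Set (Level.suc L)
    IsSublineImage = ∃₂ λ u v → det u v ≉0 × S ≐ Subline 𝔽qᵏ u v

  planar : Vector Carrier 3 → V₂
  planar w = w 0F ∷ w 1F ∷ []

  φ-subline : ∀ {m : Subset PG₂ L} {u v} → det (planar u) (planar v) ≉0 → u 2F ≈ 0# → v 2F ≈ 0# →
              m ≐ subline 𝔽qᵏ u v → φ[ m ] ≐ Subline 𝔽qᵏ (planar u) (planar v)
  φ-subline {m} {u} {v} D≉0 u₂≈0 v₂≈0 (m⊆ , ⊆m) = to , from
    where
    to : φ[ m ] ⊆ Subline 𝔽qᵏ (planar u) (planar v)
    to X (P , P∈m , P∈l∞ , X≐P) =
      let s , t , s∈ , t∈ , st≉0 , x , _ , x≉0 , P≋ = m⊆ P P∈m in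
      s · planar u ⊕ t · planar v , combination-≉𝟘 D≉0 st≉0 , spans s∈ t∈ ≋-refl ,
      ≅-trans (≐⇒≅ X≐P) (multiple⇒Block-≅ (x , x≉0 , at-01 (P≋ 0F) (P≋ 1F)))
    from : Subline 𝔽qᵏ (planar u) (planar v) ⊆ φ[ m ]
    from X (w , w≉𝟘 , spans {s} {t} s∈ t∈ w≋ , X≅w) =
      P , ⊆m P (s , t , s∈ , t∈ , st≉0 , 1# , _ , 1≉0 , w′≋) , refl ,
      ≅⇒≐ (≅-trans X≅w (≋⇒Block-≅ (at-01 refl refl)))
      where
      w′ : Vector Carrier 3
      w′ = w 0F ∷ w 1F ∷ 0# ∷ []
      P : Setoid.Carrier PG₂
      P = w′ , λ w′≋𝟘 → w≉𝟘 (at-01 (w′≋𝟘 0F) (w′≋𝟘 1F))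
      st≉0 : ¬ (s ≈ 0# × t ≈ 0#)
      st≉0 (s≈0 , t≈0) = w≉𝟘 λ i → trans (w≋ i) (trans (+-cong (*-congʳ s≈0) (*-congʳ t≈0))
        (trans (+-cong (zeroˡ _) (zeroˡ _)) (+-identityˡ 0#)))
      w′≋ : w′ ≋ (1# · λ i → s * u i + t * v i)
      w′≋ zero             = trans (w≋ 0F) (sym (*-identityˡ _))
      w′≋ (suc zero)       = trans (w≋ 1F) (sym (*-identityˡ _))
      w′≋ (suc (suc zero)) = sym (trans (*-identityˡ _) (trans
        (+-cong (trans (*-congˡ u₂≈0) (zeroʳ s)) (trans (*-congˡ v₂≈0) (zeroʳ t))) (+-identityˡ 0#)))

  combination₂ : ∀ {d} {x y : Carrier} {u v : Vector Carrier d} →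
                 combination (x ∷ y ∷ []) (u ∷ v ∷ []) ≋ x · u ⊕ y · v
  combination₂ i = +-congˡ (+-identityʳ _)

  at-012 : ∀ {p} {Q : Fin 3 → Set p} → Q 0F → Q 1F → Q 2F → ∀ i → Q i
  at-012 q₀ q₁ q₂ zero             = q₀
  at-012 q₀ q₁ q₂ (suc zero)       = q₁
  at-012 q₀ q₁ q₂ (suc (suc zero)) = q₂

  -- A vanishing determinant makes (v₀ , -u₀) and (v₁ , -u₁) linear relations between u and v.
  -- Independence then gives u₀ = u₁ = 0, so u would be zero.
  independent⇒det≉0 : ∀ {u v : Vector Carrier 3} → u 2F ≈ 0# → v 2F ≈ 0# →
    LinearlyIndependent whole (u ∷ v ∷ []) → det (planar u) (planar v) ≉0
  independent⇒det≉0 {u} {v} u₂≈0 v₂≈0 uv-ind D≈0 = 1≉0 (uv-ind (1# ∷ 0# ∷ []) _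
      (λ i → trans (combination₂ {u = u} {v} i) (trans
        (+-cong (trans (*-congˡ (u≋𝟘 i)) (zeroʳ 1#)) (zeroˡ _)) (+-identityˡ 0#))) 0F)
    where
    ann : ∀ x y → x * u 0F + y * v 0F ≈ 0# → x * u 1F + y * v 1F ≈ 0# → y ≈ 0#
    ann x y eq₀ eq₁ = uv-ind (x ∷ y ∷ []) _ (λ i → trans (combination₂ {u = u} {v} i)
      (at-012 {Q = λ i → x * u i + y * v i ≈ 0#} eq₀ eq₁ (trans
        (+-cong (trans (*-congˡ u₂≈0) (zeroʳ x)) (trans (*-congˡ v₂≈0) (zeroʳ y))) (+-identityˡ 0#)) i)) 1F
    neg≈0 : ∀ {x} → - x ≈ 0# → x ≈ 0#
    neg≈0 {x} eq = modulo (- 1#) eq (solve 1 (λ x → x :- :0 := (:- :1) :* (:- x :- :0)) refl x)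
    u≋𝟘 : u ≋ 𝟘
    u≋𝟘 = at-012
      (neg≈0 (ann (v 0F) (- u 0F) (solve 2 (λ u v → v :* u :+ (:- u) :* v := :0) refl (u 0F) (v 0F))
        (modulo (- 1#) D≈0 (solve 4 (λ u₀ u₁ v₀ v₁ → (v₀ :* u₁ :+ (:- u₀) :* v₁) :- :0 :=
          (:- :1) :* ((u₀ :* v₁ :- u₁ :* v₀) :- :0)) refl (u 0F) (u 1F) (v 0F) (v 1F)))))
      (neg≈0 (ann (v 1F) (- u 1F)
        (modulo 1# D≈0 (solve 4 (λ u₀ u₁ v₀ v₁ → (v₁ :* u₀ :+ (:- u₁) :* v₀) :- :0 :=
          :1 :* ((u₀ :* v₁ :- u₁ :* v₀) :- :0)) refl (u 0F) (u 1F) (v 0F) (v 1F)))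
        (solve 2 (λ u v → v :* u :+ (:- u) :* v := :0) refl (u 1F) (v 1F))))
      u₂≈0

  module _ (S : Subset pointSets L) where

    condition₁⇒image : condition₁ S → IsSublineImage S
    condition₁⇒image (m , (u , v , uv-ind , m⊆ , ⊆m) , m⊆l∞ , S⊆ , ⊆S) =
      planar u , planar v , D≉0 ,
      (λ X X∈S → proj₁ φ≐ X (S⊆ X X∈S)) , (λ X X∈ → ⊆S X (proj₂ φ≐ X X∈))
      where
      U V : Setoid.Carrier PG₂
      U = u , λ u≋𝟘 → 1≉0 (uv-ind (1# ∷ 0# ∷ []) _ (λ i → trans (combination₂ {u = u} {v} i)
        (trans (+-cong (trans (*-congˡ (u≋𝟘 i)) (zeroʳ 1#)) (zeroˡ _)) (+-identityˡ 0#))) 0F)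
      V = v , λ v≋𝟘 → 1≉0 (uv-ind (0# ∷ 1# ∷ []) _ (λ i → trans (combination₂ {u = u} {v} i)
        (trans (+-cong (zeroˡ _) (trans (*-congˡ (v≋𝟘 i)) (zeroʳ 1#))) (+-identityˡ 0#))) 1F)
      u₂≈0 : u 2F ≈ 0#
      u₂≈0 = m⊆l∞ U (⊆m U (1# , 0# , Kᵏ.1-closed , Kᵏ.0-closed , (λ (1≈0 , _) → 1≉0 1≈0) , 1# , _ , 1≉0 ,
        λ i → solve 2 (λ u v → u := :1 :* (:1 :* u :+ :0 :* v)) refl (u i) (v i)))
      v₂≈0 : v 2F ≈ 0#
      v₂≈0 = m⊆l∞ V (⊆m V (0# , 1# , Kᵏ.0-closed , Kᵏ.1-closed , (λ (_ , 1≈0) → 1≉0 1≈0) , 1# , _ , 1≉0 ,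
        λ i → solve 2 (λ u v → v := :1 :* (:0 :* u :+ :1 :* v)) refl (u i) (v i)))
      D≉0 : det (planar u) (planar v) ≉0
      D≉0 = independent⇒det≉0 {u} {v} u₂≈0 v₂≈0 uv-ind
      φ≐ : φ[ m ] ≐ Subline 𝔽qᵏ (planar u) (planar v)
      φ≐ = φ-subline {m} {u} {v} D≉0 u₂≈0 v₂≈0 (m⊆ , ⊆m)

    image⇒condition₁ : IsSublineImage S → condition₁ S
    image⇒condition₁ (u , v , D≉0 , S⊆ , ⊆S) =
      m , (û , v̂ , independent , (λ _ P∈ → P∈) , (λ _ P∈ → P∈)) , m⊆l∞ ,
      (λ X X∈S → proj₂ φ≐ X (proj₁ same X (S⊆ X X∈S))) , (λ X X∈ → ⊆S X (proj₂ same X (proj₁ φ≐ X X∈)))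
      where
      û v̂ : Vector Carrier 3
      û = u 0F ∷ u 1F ∷ 0# ∷ []
      v̂ = v 0F ∷ v 1F ∷ 0# ∷ []
      m : Subset PG₂ L
      m = subline 𝔽qᵏ û v̂
      independent : LinearlyIndependent whole (û ∷ v̂ ∷ [])
      independent xs _ eq = at-01 (proj₁ x≈0) (proj₂ x≈0)
        where
        x≈0 : xs 0F ≈ 0# × xs 1F ≈ 0#
        x≈0 = combination≋𝟘 {u} {v} D≉0 {xs 0F} {xs 1F} (at-01
          (trans (+-congˡ (sym (+-identityʳ _))) (eq 0F)) (trans (+-congˡ (sym (+-identityʳ _))) (eq 1F)))
      m⊆l∞ : m ⊆ l∞
      m⊆l∞ (w , _) (s , t , _ , _ , _ , x , _ , _ , w≋) = trans (w≋ 2F)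
        (solve 3 (λ x s t → x :* (s :* :0 :+ t :* :0) := :0) refl x s t)
      φ≐ : φ[ m ] ≐ Subline 𝔽qᵏ (planar û) (planar v̂)
      φ≐ = φ-subline {m} {û} {v̂} D≉0 refl refl ((λ _ P∈ → P∈) , (λ _ P∈ → P∈))
      same : Subline 𝔽qᵏ u v ≐ Subline 𝔽qᵏ (planar û) (planar v̂)
      same = Subline-≐ 𝔽qᵏ
        (spans Kᵏ.1-closed Kᵏ.0-closed (at-01 (lem₁ (u 0F) (v 0F)) (lem₁ (u 1F) (v 1F))))
        (spans Kᵏ.0-closed Kᵏ.1-closed (at-01 (lem₂ (u 0F) (v 0F)) (lem₂ (u 1F) (v 1F)))) D≉0
        where
        lem₁ : ∀ u v → u ≈ 1# * u + 0# * v
        lem₁ = solve 2 (λ u v → u := :1 :* u :+ :0 :* v) refl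
        lem₂ : ∀ u v → v ≈ 0# * u + 1# * v
        lem₂ = solve 2 (λ u v → v := :0 :* u :+ :1 :* v) refl

    -- A frame over 𝔽qᵏ brings the three elements to standard position; their regulus is then the
    -- 𝔽q-subline, contained in the 𝔽qᵏ-subline of the same frame.
    image⇒condition₂ : IsSublineImage S → condition₂ S
    image⇒condition₂ (u , v , D≉0 , S⊆ , ⊆S) A B C A∈ B∈ C∈ distinct =
      (Subline 𝔽q e f , Subline-isRegulusThrough independent A≅ B≅ C≅ ,
        λ {R} → unique-regulus independent A≅ B≅ C≅ distinct {R}) ,
      λ X X∈ → ⊆S X (proj₂ same X (Subline-mono X X∈))
      where open Frame (frame 𝔽qᵏ (S⊆ A A∈) (S⊆ B B∈) (S⊆ C C∈) distinct)

    -- W is 𝔽qᵏ u + 𝔽qᵏ v, which meets the element ⟨w⟩ exactly in 𝔽qᵏ w when w has coordinates in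
    -- 𝔽qᵏ.
    image⇒condition₄ : IsSublineImage S → condition₄ S
    image⇒condition₄ (u , v , D≉0 , S⊆ , ⊆S) = W ,
      subspace⇒dimension 𝔽q |𝔽q| |𝔽| q>1 W Ws (combinations-isSubspace 𝔽qᵏ 𝔽q⊆𝔽qᵏ u v)
        (≡.subst (HasSize (elements Ws)) qᵏqᵏ≡q²ᵏ (combinations-size 𝔽qᵏ D≉0 |𝔽qᵏ|))
        (λ P → mk⇔ (λ P∈ → P∈) (λ P∈ → P∈)) ,
      section
      where
      Ws : Subset (≋-setoid 2) L
      Ws = combinations 𝔽qᵏ u v
      W : PointSet
      W = projectivization Ws (combinations-isSubspace 𝔽qᵏ 𝔽q⊆𝔽qᵏ u v)
      qᵏqᵏ≡q²ᵏ : q ℕ.^ k ℕ.* q ℕ.^ k ≡ q ℕ.^ (2 ℕ.* k)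
      qᵏqᵏ≡q²ᵏ = ≡.trans (≡.sym (ℕ.^-distribˡ-+-* q k k)) (≡.cong (λ j → q ℕ.^ (k ℕ.+ j)) (≡.sym (ℕ.+-identityʳ k)))
      section : ∀ X → X ∈ S → W ∩ X is⟨ k -1⟩-dimensional × W ∩ X ∈ spread 𝔽qᵏ
      section X X∈S = subspace⇒dimension 𝔽q |𝔽q| |𝔽| q>1 (W ∩ X) (multiples 𝔽qᵏ w)
          (multiples-isSubspace 𝔽qᵏ 𝔽q⊆𝔽qᵏ w) (multiples-size 𝔽qᵏ w≉𝟘 |𝔽qᵏ|) (λ P → mk⇔ (to P) (from P)) ,
        (w , w≉𝟘 , (λ P P∈ → let x , x∈ , P≋ = to P P∈ in
                       x , x∈ , ≉𝟘⇒≉0 {w = w} (proj₂ P) P≋ , 1# , K.1-closed , 1≉0 ,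
                       λ i → trans (P≋ i) (sym (*-identityˡ _)))
                   , (λ P (x , x∈ , _ , y , y∈ , _ , P≋) → from P
                       (y * x , Kᵏ.*-closed (𝔽q⊆𝔽qᵏ y∈) x∈ , λ i → trans (P≋ i) (sym (*-assoc y x _)))))
        where
        w : V₂
        w = proj₁ (S⊆ X X∈S)
        w≉𝟘 : w ≉𝟘
        w≉𝟘 = proj₁ (proj₂ (S⊆ X X∈S))
        w∈ : Span₂ 𝔽qᵏ u v w
        w∈ = proj₁ (proj₂ (proj₂ (S⊆ X X∈S)))
        X≅w : X ≅ Block w
        X≅w = proj₂ (proj₂ (proj₂ (S⊆ X X∈S)))
        open Span₂ w∈ using (s; t) renaming (s∈K to s∈; t∈K to t∈; equation to w≋)
        from : ∀ P → ∃[ x ] x ∈ₖ 𝔽qᵏ × proj₁ P ≋ x · w → P ∈ (W ∩ X)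
        from P (x , x∈ , P≋) = respect Ws (≋-sym P≋) (Span₂-scale 𝔽qᵏ x∈ w∈) ,
          proj₂ (≅⇒≐ X≅w) P (⇒∈Block P {x} P≋)
        ratio : ∀ {x y z} → y ≉0 → y ∈ₖ 𝔽qᵏ → z ∈ₖ 𝔽qᵏ → x * y ≈ z → x ∈ₖ 𝔽qᵏ
        ratio {x} {y} {z} y≉0 y∈ z∈ xy≈z = respect Kᵏ.subset
          (modulo₂ (- (y ⁻¹)) x xy≈z (x*x⁻¹≈1 y≉0)
            (solve 4 (λ x y z j → z :* j :- x := (:- j) :* (x :* y :- z) :+ x :* (y :* j :- :1)) refl x y z (y ⁻¹)))
          (Kᵏ.*-closed z∈ (⁻¹-closed 𝔽qᵏ y≉0 y∈))
        to : ∀ P → P ∈ (W ∩ X) → ∃[ x ] x ∈ₖ 𝔽qᵏ × proj₁ P ≋ x · w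
        to P (spans {s′} {t′} s′∈ t′∈ P≋′ , P∈X) =
          let x , _ , P≋ = ∈Block⇒ P (proj₁ (≅⇒≐ X≅w) P P∈X)
              xs≈ , xt≈ = coordinates-unique D≉0 {x * s} {x * t} {s′} {t′} λ i → trans
                (trans (solve 5 (λ x s t u v → (x :* s) :* u :+ (x :* t) :* v := x :* (s :* u :+ t :* v))
                    refl x s t (u i) (v i))
                  (trans (*-congˡ (sym (w≋ i))) (sym (P≋ i)))) (P≋′ i)
          -- P = x w lies in W, so x s and x t are in 𝔽qᵏ; dividing by a nonzero one of s, t shows x
          -- in 𝔽qᵏ.
          in x , (case s ≟ 0# of λ
            { (no s≉0) → ratio s≉0 s∈ s′∈ xs≈
            ; (yes s≈0) → ratio (λ t≈0 → w≉𝟘 λ i → trans (w≋ i) (trans (+-cong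
                 (trans (*-congʳ s≈0) (zeroˡ _)) (trans (*-congʳ t≈0) (zeroˡ _))) (+-identityˡ 0#))) t∈ t′∈ xt≈
            }) , P≋

    module _ (S⊆𝒟 : S ⊆ 𝒟) (|S| : HasSize (elements S) (suc (q ℕ.^ k))) where

      private
        S-resp : ∀ {X Y} → X ≅ Y → X ∈ S → Y ∈ S
        S-resp {X} {Y} X≅Y = respect S {X} {Y} (≅⇒≐ X≅Y)

      record Coordinates : Set L where
        field
          {u v} : V₂
          det≉0 : det u v ≉0
          u∈S : Block u ∈ S
          v∈S : Block v ∈ S
          u⊕v∈S : Block (u ⊕ v) ∈ S

      three-elements : ∀ {M} → HasSize (elements S) M → M ℕ.> 2 →
        Σ[ A ∈ PointSet ] Σ[ B ∈ PointSet ] Σ[ C ∈ PointSet ] A ∈ S × B ∈ S × C ∈ S × PairwiseDistinct A B C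
      three-elements |S| (s≤s (s≤s (s≤s _))) =
        proj₁ (e 0F) , proj₁ (e 1F) , proj₁ (e 2F) , proj₂ (e 0F) , proj₂ (e 1F) , proj₂ (e 2F) ,
        (λ eq → case enum-injective |S| {0F} {1F} eq of λ ()) ,
        (λ eq → case enum-injective |S| {0F} {2F} eq of λ ()) ,
        (λ eq → case enum-injective |S| {1F} {2F} eq of λ ())
        where
        e : _ → ∃ (member S)
        e = enum |S|

      abstract
        -- S has q^k + 1 > 2 elements; any three of them are framed over 𝔽, starting from the
        -- standard basis.
        coordinates-exist : Coordinates
        coordinates-exist =
          let A , B , C , A∈ , B∈ , C∈ , distinct = three-elements |S| (s≤s qᵏ>1)
          in framed A∈ B∈ C∈ (frame whole {e₁} {e₂} {A} {B} {C}
             (S⊆Subline A A∈) (S⊆Subline B B∈) (S⊆Subline C C∈) distinct)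
          where
          e₁ e₂ : V₂
          e₁ = 1# ∷ 0# ∷ []
          e₂ = 0# ∷ 1# ∷ []
          S⊆Subline : S ⊆ Subline whole e₁ e₂
          S⊆Subline X X∈S = 𝒟⊆Subline {e₁} {e₂}
            (≉0-resp (solve 0 (:1 := :1 :* :1 :- :0 :* :0) refl) 1≉0) X (S⊆𝒟 X X∈S)
          framed : ∀ {A B C} → A ∈ S → B ∈ S → C ∈ S → Frame whole e₁ e₂ A B C → Coordinates
          framed A∈ B∈ C∈ F = record
            { det≉0 = independent ; u∈S = S-resp A≅ A∈ ; v∈S = S-resp B≅ B∈ ; u⊕v∈S = S-resp C≅ C∈ }
            where open Frame F

      -- The set T, with u and v kept as arguments because the exchanged set `slopes v u` is needed
      -- as well.
      slopes : V₂ → V₂ → Subset setoid L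
      slopes u v = record
        { member  = λ t → Block (u ⊕ t · v) ∈ S
        ; respect = λ {s} {t} s≈t → S-resp (≋⇒Block-≅ {u ⊕ s · v} {u ⊕ t · v} λ i → +-congˡ (*-congʳ s≈t))
        }

      1∈slopes : ∀ {u v} → Block (u ⊕ v) ∈ S → 1# ∈ slopes u v
      1∈slopes {u} {v} = S-resp (≋⇒Block-≅ {u ⊕ v} {u ⊕ 1# · v} λ i → +-congˡ (sym (*-identityˡ (v i))))

      0∈slopes : ∀ {u v} → Block u ∈ S → 0# ∈ slopes u v
      0∈slopes {u} {v} = S-resp (≋⇒Block-≅ {u} {u ⊕ 0# · v} λ i →
        solve 2 (λ u v → u := u :+ :0 :* v) refl (u i) (v i))

      -- Each of the q^k elements of S other than ⟨v⟩ has exactly one slope.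
      slopes-size : ∀ {u v} → det u v ≉0 → Block v ∈ S → HasSize (elements (slopes u v)) (q ℕ.^ k)
      slopes-size {u} {v} D≉0 v∈S = transport-size⁻ {A = elements (slopes u v)} {B = elements (S ∖ Block v)}
        (λ (t , t∈) → Block (u ⊕ t · v) , t∈ , λ (t⊆∞ , _) → slope≢∞ D≉0 t⊆∞)
        (λ (X⊆Y , _) → slope-injective D≉0 X⊆Y)
        (λ {(s , _)} {(t , _)} s≈t → ≅⇒≐ (≋⇒Block-≅ {u ⊕ s · v} {u ⊕ t · v} λ i → +-congˡ (*-congʳ s≈t)))
        surjective
        (∖-size {X = S} v∈S |S|)
        where
        surjective : ∀ ((X , _) : ∃ (member (S ∖ Block v))) → ∃[ t ] Block (u ⊕ proj₁ t · v) ≐ X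
        surjective (X , X∈S , X≢∞) = case Subline⇒slope D≉0 whole {X} (𝒟⊆Subline D≉0 X (S⊆𝒟 X X∈S)) of λ
          { (inj₁ X≅∞) → contradiction (≅⇒≐ X≅∞) X≢∞
          ; (inj₂ (t , _ , X≅t)) → (t , S-resp X≅t X∈S) , ≅⇒≐ (≅-sym X≅t)
          }

      slopes-multiplicative⇒image : ∀ {u v} → det u v ≉0 → Block u ∈ S → Block v ∈ S →
        (∀ {x y} → x ∈ slopes u v → y ∈ slopes u v → x * y ∈ slopes u v) → IsSublineImage S
      slopes-multiplicative⇒image {u} {v} D≉0 u∈S v∈S *-closed = u , v , D≉0 , S⊆ , ⊆S
        where
        T≐ : slopes u v ≐ Kᵏ.subset
        T≐ = multiplicative⇒𝔽qᵏ {T = slopes u v} (slopes-size D≉0 v∈S) (0∈slopes {u} {v} u∈S) *-closed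
        Subline-resp : ∀ {X Y} → X ≅ Y → X ∈ Subline 𝔽qᵏ u v → Y ∈ Subline 𝔽qᵏ u v
        Subline-resp {X} {Y} X≅Y = respect (Subline 𝔽qᵏ u v) {X} {Y} (≅⇒≐ X≅Y)
        S⊆ : S ⊆ Subline 𝔽qᵏ u v
        S⊆ X X∈S = case Subline⇒slope D≉0 whole {X} (𝒟⊆Subline D≉0 X (S⊆𝒟 X X∈S)) of λ
          { (inj₁ X≅∞) → Subline-resp (≅-sym X≅∞) (∞∈Subline D≉0 𝔽qᵏ)
          ; (inj₂ (t , _ , X≅t)) → Subline-resp (≅-sym X≅t)
              (slope∈Subline D≉0 𝔽qᵏ (proj₁ T≐ t (S-resp X≅t X∈S)))
          }
        ⊆S : Subline 𝔽qᵏ u v ⊆ S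
        ⊆S X X∈ = case Subline⇒slope D≉0 𝔽qᵏ {X} X∈ of λ
          { (inj₁ X≅∞) → S-resp (≅-sym X≅∞) v∈S
          ; (inj₂ (t , t∈ , X≅t)) → S-resp (≅-sym X≅t) (proj₂ T≐ t t∈)
          }

      -- If 𝔽q contained only 0 and 1, testing for 0 would inject it into `Fin 2`, against q > 2.
      scalar≉0,1 : ∃[ μ ] μ ∈ₖ 𝔽q × μ ≉0 × (1# - μ) ≉0
      scalar≉0,1 = find |𝔽q| q>2
        where
        find : ∀ {M} → HasSize (elements K.subset) M → M ℕ.> 2 → ∃[ μ ] μ ∈ₖ 𝔽q × μ ≉0 × (1# - μ) ≉0
        find {M} |K| M>2 = case any? (λ i → ¬? (e i ≟ 0#) ×-dec ¬? ((1# - e i) ≟ 0#)) of λ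
          { (yes (i , μ≉0 , 1-μ≉0)) → e i , proj₂ (enum |K| i) , μ≉0 , 1-μ≉0
          ; (no none) → contradiction (two none) (ℕ.<⇒≱ M>2)
          }
          where
          e : Fin M → Carrier
          e i = proj₁ (enum |K| i)
          two : ¬ (∃[ i ] e i ≉0 × (1# - e i) ≉0) → M ℕ.≤ 2
          two none = injective⇒≤ {f = f} λ {i} {j} → f-inj i j (e i ≟ 0#) (e j ≟ 0#)
            where
            f-of : ∀ {x} → Dec (x ≈ 0#) → Fin 2
            f-of (yes _) = 0F
            f-of (no _)  = 1F
            f : Fin M → Fin 2
            f i = f-of (e i ≟ 0#)
            e≈1 : ∀ i → e i ≉0 → e i ≈ 1#
            e≈1 i eᵢ≉0 = sym (x-y≈0⇒x≈y (decidable-stable ((1# - e i) ≟ 0#) λ 1-e≉0 → none (i , eᵢ≉0 , 1-e≉0)))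
            f-inj : ∀ i j (dᵢ : Dec (e i ≈ 0#)) (dⱼ : Dec (e j ≈ 0#)) → f-of dᵢ ≡ f-of dⱼ → i ≡ j
            f-inj i j (yes eᵢ≈0) (yes eⱼ≈0) _ = enum-injective |K| (trans eᵢ≈0 (sym eⱼ≈0))
            f-inj i j (no eᵢ≉0)  (no eⱼ≉0)  _ = enum-injective |K| (trans (e≈1 i eᵢ≉0) (sym (e≈1 j eⱼ≉0)))

      -- The form the second condition takes once the regulus through ⟨e⟩, ⟨f⟩, ⟨e + f⟩ is known to
      -- be the 𝔽q-subline.
      SublineClosed : Set (Level.suc L)
      SublineClosed = ∀ e f → det e f ≉0 → Block e ∈ S → Block f ∈ S → Block (e ⊕ f) ∈ S → Subline 𝔽q e f ⊆ S

      module _ (sublines : SublineClosed) where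

        abstract
          -- With e = u + a v and f = (b - a) v, the elements ⟨e⟩, ⟨e + f⟩, ⟨f⟩ have slopes a, b, ∞,
          -- and ⟨e + μ f⟩ in their regulus has slope a + μ (b - a).
          slopes-affine : ∀ {u v} → det u v ≉0 → Block v ∈ S → ∀ {a b μ} →
            a ∈ slopes u v → b ∈ slopes u v → μ ∈ₖ 𝔽q → a + μ * (b - a) ∈ slopes u v
          slopes-affine {u} {v} D≉0 v∈S {a} {b} {μ} a∈ b∈ μ∈ = case (b - a) ≟ 0# of λ
            { (yes b-a≈0) → respect (slopes u v) {a} {a + μ * (b - a)}
                (sym (trans (+-congˡ (trans (*-congˡ b-a≈0) (zeroʳ μ))) (+-identityʳ a))) a∈
            ; (no b-a≉0) → S-resp (≋⇒Block-≅ {e ⊕ μ · f} {u ⊕ (a + μ * (b - a)) · v} λ i →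
                  solve 5 (λ a b μ u v → (u :+ a :* v) :+ μ :* ((b :- a) :* v) := u :+ (a :+ μ :* (b :- a)) :* v)
                    refl a b μ (u i) (v i))
                (sublines e f (ef≉0 b-a≉0) a∈ (S-resp (≅-sym (multiple⇒Block-≅ (b - a , b-a≉0 , ≋-refl))) v∈S)
                  (S-resp (≋⇒Block-≅ {u ⊕ b · v} {e ⊕ f} λ i →
                    solve 4 (λ a b u v → u :+ b :* v := (u :+ a :* v) :+ (b :- a) :* v) refl a b (u i) (v i)) b∈)
                  (Block (e ⊕ μ · f)) (slope∈Subline (ef≉0 b-a≉0) 𝔽q μ∈))
            }
            where
            e f : V₂
            e = u ⊕ a · v
            f = (b - a) · v
            ef≉0 : (b - a) ≉0 → det e f ≉0
            ef≉0 b-a≉0 = ≉0-resp (solve 6 (λ a x u₀ u₁ v₀ v₁ → x :* (u₀ :* v₁ :- u₁ :* v₀) :=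
              (u₀ :+ a :* v₀) :* (x :* v₁) :- (u₁ :+ a :* v₁) :* (x :* v₀)) refl
              a (b - a) (u 0F) (u 1F) (v 0F) (v 1F)) (*-≉0 b-a≉0 D≉0)

          -- a + b = (1 - μ) a′ + μ b′ with a′ = a / (1 - μ) and b′ = b / μ; this
          -- is where q > 2 is needed.
          slopes-additive : ∀ {u v} → det u v ≉0 → Block u ∈ S → Block v ∈ S → IsAdditive (slopes u v)
          slopes-additive {u} {v} D≉0 u∈S v∈S = record
            { 0∈ = 0∈
            ; +-closed = λ {a} {b} a∈ b∈ → respect T {a * ν ⁻¹ + μ * (b * μ ⁻¹ - a * ν ⁻¹)} {a + b}
                (modulo₂ a b (x*x⁻¹≈1 ν≉0) (x*x⁻¹≈1 μ≉0)
                  (solve 5 (λ a b μ i j → (a :* j :+ μ :* (b :* i :- a :* j)) :- (a :+ b) :=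
                    a :* ((:1 :- μ) :* j :- :1) :+ b :* (μ :* i :- :1)) refl a b μ (μ ⁻¹) (ν ⁻¹)))
                (affine (scale a∈ (⁻¹-closed 𝔽q ν≉0 (K.+-closed K.1-closed (K.neg-closed μ∈))))
                        (scale b∈ (⁻¹-closed 𝔽q μ≉0 μ∈)) μ∈)
            ; neg-closed = λ {a} a∈ → respect T {a * - 1#} { - a} (solve 1 (λ a → a :* (:- :1) := :- a) refl a)
                (scale a∈ (K.neg-closed K.1-closed))
            }
            where
            T : Subset setoid L
            T = slopes u v
            affine : ∀ {a b μ} → a ∈ T → b ∈ T → μ ∈ₖ 𝔽q → a + μ * (b - a) ∈ T
            affine {a} {b} {μ} = slopes-affine D≉0 v∈S {a} {b} {μ}
            0∈ : 0# ∈ T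
            0∈ = 0∈slopes {u} {v} u∈S
            scale : ∀ {a x} → a ∈ T → x ∈ₖ 𝔽q → a * x ∈ T
            scale {a} {x} a∈ x∈ = respect T {0# + x * (a - 0#)} {a * x}
              (solve 2 (λ a x → :0 :+ x :* (a :- :0) := a :* x) refl a x) (affine 0∈ a∈ x∈)
            μ ν : Carrier
            μ = proj₁ scalar≉0,1
            ν = 1# - μ
            μ∈ : μ ∈ₖ 𝔽q
            μ∈ = proj₁ (proj₂ scalar≉0,1)
            μ≉0 : μ ≉0
            μ≉0 = proj₁ (proj₂ (proj₂ scalar≉0,1))
            ν≉0 : ν ≉0
            ν≉0 = proj₂ (proj₂ (proj₂ scalar≉0,1))

          -- u + t v = t (v + t⁻¹ u), so both vectors span the same element.
          slopes-swap : ∀ {u v t} → t ∈ slopes u v → t ≉0 → t ⁻¹ ∈ slopes v u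
          slopes-swap {u} {v} {t} t∈ t≉0 = S-resp (multiple⇒Block-≅ {u ⊕ t · v} {v ⊕ t ⁻¹ · u} (t , t≉0 , λ i →
            modulo (- u i) (x*x⁻¹≈1 t≉0) (solve 4 (λ t j u v → (u :+ t :* v) :- t :* (v :+ j :* u) :=
              (:- u) :* (t :* j :- :1)) refl t (t ⁻¹) (u i) (v i)))) t∈

      condition₂⇒image : ∀ {u v} → det u v ≉0 → Block u ∈ S → Block v ∈ S → Block (u ⊕ v) ∈ S →
                         condition₂ S → IsSublineImage S
      condition₂⇒image {u} {v} det≉0 u∈S v∈S u⊕v∈S regular = slopes-multiplicative⇒image {u} {v} det≉0 u∈S v∈S
          (λ {x} {y} → *-closed {T = slopes u v} {slopes v u} add add′ 1∈ 1∈′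
            (λ {t} → slopes-swap sublines {u} {v} {t}) (λ {t} → slopes-swap sublines {v} {u} {t})
            (slopes-size {u} {v} det≉0 v∈S) {x} {y})
        where
        det≉0′ : det v u ≉0
        det≉0′ D≈0 = det≉0 (modulo (- 1#) D≈0 (solve 4 (λ u₀ u₁ v₀ v₁ → (u₀ :* v₁ :- u₁ :* v₀) :- :0 :=
          (:- :1) :* ((v₀ :* u₁ :- v₁ :* u₀) :- :0)) refl (u 0F) (u 1F) (v 0F) (v 1F)))
        sublines : SublineClosed
        -- Uniqueness identifies the 𝔽q-subline with the regulus that the condition places in S.
        sublines e f ef≉0 e∈ f∈ ef∈ X X∈ = proj₂ regulus X
          (proj₂ (proj₂ (proj₂ (proj₁ regulus)) {Subline 𝔽q e f} standard) X X∈)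
          where
          standard : IsRegulusThrough q n (Block e) (Block f) (Block (e ⊕ f)) (Subline 𝔽q e f)
          standard = Subline-isRegulusThrough {e} {f} ef≉0 {Block e} {Block f} {Block (e ⊕ f)} ≅-refl ≅-refl ≅-refl
          parallel : ∀ {a b} → a ≉𝟘 → Block a ≐ Block b → det a b ≈ 0#
          parallel {a} {b} a≉𝟘 (a⊆b , _) = multiple⇒det≈0 {a} {b} (Block-⊆⇒multiple {a} {b} a≉𝟘 a⊆b)
          det-e : det e (e ⊕ f) ≈ det e f
          det-e = solve 4 (λ e₀ e₁ f₀ f₁ → e₀ :* (e₁ :+ f₁) :- e₁ :* (e₀ :+ f₀) := e₀ :* f₁ :- e₁ :* f₀)
            refl (e 0F) (e 1F) (f 0F) (f 1F)
          det-f : - det f (e ⊕ f) ≈ det e f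
          det-f = solve 4 (λ e₀ e₁ f₀ f₁ → :- (f₀ :* (e₁ :+ f₁) :- f₁ :* (e₀ :+ f₀)) := e₀ :* f₁ :- e₁ :* f₀)
            refl (e 0F) (e 1F) (f 0F) (f 1F)
          -- det e (e + f) = det e f = -det f (e + f), so no two of the three vectors are parallel.
          distinct : PairwiseDistinct (Block e) (Block f) (Block (e ⊕ f))
          distinct =
            (λ eq → ef≉0 (parallel {e} {f} (u≉𝟘 {e} {f} ef≉0) eq)) ,
            (λ eq → ef≉0 (trans (sym det-e) (parallel {e} {e ⊕ f} (u≉𝟘 {e} {f} ef≉0) eq))) ,
            (λ eq → ef≉0 (trans (sym det-f) (trans (-‿cong (parallel {f} {e ⊕ f} (v≉𝟘 {e} {f} ef≉0) eq))
              (solve 0 (:- :0 := :0) refl))))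
          regulus : Σ[ R! ∈ ∃! _≐_ (IsRegulusThrough q n (Block e) (Block f) (Block (e ⊕ f))) ] proj₁ R! ⊆ S
          regulus = regular (Block e) (Block f) (Block (e ⊕ f)) e∈ f∈ ef∈ distinct
        add : IsAdditive (slopes u v)
        add = slopes-additive sublines {u} {v} det≉0 u∈S v∈S
        add′ : IsAdditive (slopes v u)
        add′ = slopes-additive sublines {v} {u} det≉0′ v∈S u∈S
        1∈ : 1# ∈ slopes u v
        1∈ = 1∈slopes {u} {v} u⊕v∈S
        1∈′ : 1# ∈ slopes v u
        1∈′ = 1∈slopes {v} {u} (S-resp (≋⇒Block-≅ {u ⊕ v} {v ⊕ u} λ i → +-comm _ _) u⊕v∈S)

      condition₃⇒image : ∀ {u v} → det u v ≉0 → Block u ∈ S → Block v ∈ S → Block (u ⊕ v) ∈ S →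
                         condition₃ S → IsSublineImage S
      condition₃⇒image {u} {v} det≉0 u∈S v∈S u⊕v∈S (W , W-dim , W∩-dim) =
        slopes-multiplicative⇒image {u} {v} det≉0 u∈S v∈S T-closed
        where
        W-subspace : Σ[ V ∈ Subset (≋-setoid 2) L ] IsSubspace 𝔽q V ×
          HasSize (elements V) (q ℕ.^ (2 ℕ.* k)) × IsProjectivization 𝔽q |𝔽q| |𝔽| W V
        W-subspace = dimension⇒subspace 𝔽q |𝔽q| |𝔽| W W-dim
        Ws : Subset (≋-setoid 2) L
        Ws = proj₁ W-subspace
        open IsSubspace (proj₁ (proj₂ W-subspace))
        W⇔ : IsProjectivization 𝔽q |𝔽q| |𝔽| W Ws
        W⇔ = proj₂ (proj₂ (proj₂ W-subspace))
        |W| : HasSize (elements Ws) (q ℕ.^ k ℕ.* q ℕ.^ k)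
        |W| = ≡.subst (HasSize (elements Ws))
          (≡.trans (≡.cong (λ j → q ℕ.^ (k ℕ.+ j)) (ℕ.+-identityʳ k)) (ℕ.^-distribˡ-+-* q k k))
          (proj₁ (proj₂ (proj₂ W-subspace)))

        -- Recording scalars instead of vectors allows the traces of W on different elements of S to
        -- be compared inside 𝔽.
        fibre : V₂ → Subset setoid L
        fibre w = record
          { member  = λ x → x · w ∈ Ws
          ; respect = λ x≈y → respect Ws (λ i → *-congʳ x≈y)
          }

        fibre-size : ∀ {w} → w ≉𝟘 → Block w ∈ S → HasSize (elements (fibre w)) (q ℕ.^ k)
        fibre-size {w} w≉𝟘 w∈S = transport-size⁻ {A = elements (fibre w)} {B = elements V}
          (λ (x , x∈) → x · w , inV x x∈) (·-injective w≉𝟘) (λ x≈y i → *-congʳ x≈y) surjective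
          (proj₁ (proj₂ (proj₂ V-subspace)))
          where
          V-subspace : Σ[ V ∈ Subset (≋-setoid 2) L ] IsSubspace 𝔽q V ×
            HasSize (elements V) (q ℕ.^ k) × IsProjectivization 𝔽q |𝔽q| |𝔽| (W ∩ Block w) V
          V-subspace = dimension⇒subspace 𝔽q |𝔽q| |𝔽| (W ∩ Block w) (W∩-dim (Block w) w∈S)
          V : Subset (≋-setoid 2) L
          V = proj₁ V-subspace
          V⇔ : IsProjectivization 𝔽q |𝔽q| |𝔽| (W ∩ Block w) V
          V⇔ = proj₂ (proj₂ (proj₂ V-subspace))
          inV : ∀ x → x · w ∈ Ws → x · w ∈ V
          -- 𝟘 is not a point, so x = 0 cannot be handled through W ∩ ⟨w⟩ and comes from the linear
          -- subspace directly.
          inV x xw∈W = case x ≟ 0# of λ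
            { (yes x≈0) → respect V (λ i → sym (trans (*-congʳ x≈0) (zeroˡ _)))
                (IsSubspace.𝟘-closed (proj₁ (proj₂ V-subspace)))
            ; (no x≉0) → let P = x · w , ·-≉𝟘 x≉0 w≉𝟘 in
                Equivalence.to (V⇔ P) (Equivalence.from (W⇔ P) xw∈W , ⇒∈Block P {x} ≋-refl)
            }
          surjective : ∀ ((y , _) : ∃ (member V)) → Σ[ x ∈ ∃ (member (fibre w)) ] proj₁ x · w ≋ y
          surjective (y , y∈V) = case (y 0F ≟ 0#) ×-dec (y 1F ≟ 0#) of λ
            { (yes (y₀≈0 , y₁≈0)) → (0# , respect Ws (λ i → sym (zeroˡ (w i))) 𝟘-closed) ,
                at-01 (trans (zeroˡ _) (sym y₀≈0)) (trans (zeroˡ _) (sym y₁≈0))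
            ; (no y≉0) → let P = y , (λ y≋𝟘 → y≉0 (y≋𝟘 0F , y≋𝟘 1F))
                             P∈W , P∈w = Equivalence.from (V⇔ P) y∈V
                             x , _ , y≋xw = ∈Block⇒ P P∈w
                         in (x , respect Ws y≋xw (Equivalence.to (W⇔ P) P∈W)) , ≋-sym y≋xw
            }

        u≉ : u ≉𝟘
        u≉ = u≉𝟘 {u} {v} det≉0
        v≉ : v ≉𝟘
        v≉ = v≉𝟘 {u} {v} det≉0
        u⊕v≉ : u ⊕ v ≉𝟘
        u⊕v≉ eq = combination-≉𝟘 {u} {v} det≉0 {1#} {1#} (λ (1≈0 , _) → 1≉0 1≈0)
          (λ i → trans (+-cong (*-identityˡ _) (*-identityˡ _)) (eq i))
        Xᵤ Xᵥ X₊ : Subset setoid L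
        Xᵤ = fibre u
        Xᵥ = fibre v
        X₊ = fibre (u ⊕ v)
        |Xᵤ| : HasSize (elements Xᵤ) (q ℕ.^ k)
        |Xᵤ| = fibre-size {u} u≉ u∈S
        |Xᵥ| : HasSize (elements Xᵥ) (q ℕ.^ k)
        |Xᵥ| = fibre-size {v} v≉ v∈S
        |X₊| : HasSize (elements X₊) (q ℕ.^ k)
        |X₊| = fibre-size {u ⊕ v} u⊕v≉ u⊕v∈S

        -- The q^k q^k sums of vectors of W along u and along v already exhaust W, so both
        -- components of a vector of W lie in W.
        W-coordinates : ∀ {x y} → x · u ⊕ y · v ∈ Ws → x ∈ Xᵤ × y ∈ Xᵥ
        W-coordinates {x} {y} w∈ =
          let x′ , y′ , x′∈ , y′∈ , eq = exhaust-coordinates {A = Xᵤ} {B = Xᵥ} {V = Ws} |Xᵤ| |Xᵥ| |W| {u} {v} det≉0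
                (λ x∈ y∈ → ⊕-closed x∈ y∈) {x · u ⊕ y · v} w∈
              x≈ , y≈ = coordinates-unique det≉0 {x} {y} {x′} {y′} eq
          in respect Xᵤ (sym x≈) x′∈ , respect Xᵥ (sym y≈) y′∈

        X₊⊆ : ∀ {x} → x ∈ X₊ → x ∈ Xᵤ × x ∈ Xᵥ
        X₊⊆ {x} x∈ = W-coordinates (respect Ws (λ i → distribˡ x (u i) (v i)) x∈)

        -- X₊ is contained in Xᵤ and in Xᵥ, and it has the size of Xᵥ. This is the use of ⟨u + v⟩ ∈
        -- S.
        Xᵥ⊆Xᵤ : Xᵥ ⊆ Xᵤ
        Xᵥ⊆Xᵤ x x∈ = proj₁ (X₊⊆ (⊆-size⇒⊇ {X = X₊} |X₊| {Y = Xᵥ} |Xᵥ| (λ y y∈ → proj₂ (X₊⊆ y∈)) x x∈))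

        T : Subset setoid L
        T = slopes u v

        -- If x (u + t v) is in W, then x lies in Xᵤ and x t in Xᵥ. By size, the fibre of u + t v is
        -- all of Xᵤ, so this applies to every x in Xᵤ.
        TX⊆X : ∀ {t} → t ∈ T → ∀ {x} → x ∈ Xᵤ → x * t ∈ Xᵤ
        TX⊆X {t} t∈ {x} x∈ = Xᵥ⊆Xᵤ _ (proj₂ (split (⊆-size⇒⊇ {X = fibre (u ⊕ t · v)}
            (fibre-size {u ⊕ t · v} (slope-≉𝟘 {u} {v} det≉0 t) t∈) {Y = Xᵤ} |Xᵤ| (λ y y∈ → proj₁ (split y∈)) x x∈)))
          where
          split : ∀ {x} → x ∈ fibre (u ⊕ t · v) → x ∈ Xᵤ × x * t ∈ Xᵥ
          split {x} x∈ = W-coordinates (respect Ws (λ i →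
            solve 4 (λ x t u v → x :* (u :+ t :* v) := x :* u :+ (x :* t) :* v) refl x t (u i) (v i)) x∈)

        x₀-exists : ∃[ x ] x ∈ Xᵤ × x ≉0
        x₀-exists = nonzero-element {X = Xᵤ} |Xᵤ| qᵏ>1
        x₀ : Carrier
        x₀ = proj₁ x₀-exists
        x₀∈ : x₀ ∈ Xᵤ
        x₀∈ = proj₁ (proj₂ x₀-exists)
        x₀≉0 : x₀ ≉0
        x₀≉0 = proj₂ (proj₂ x₀-exists)

        X⊆x₀T : ∀ {x} → x ∈ Xᵤ → ∃[ t ] t ∈ T × x₀ * t ≈ x
        X⊆x₀T {x} x∈ =
          let (t , t∈) , eq = injective⇒surjective {A = elements T} {B = elements Xᵤ}
                (λ (t , t∈) → x₀ * t , TX⊆X t∈ x₀∈) (*-cancelˡ-≉0 x₀≉0) (slopes-size det≉0 v∈S) |Xᵤ| (x , x∈)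
          in t , t∈ , eq

        T-closed : ∀ {s t} → s ∈ T → t ∈ T → s * t ∈ T
        T-closed {s} {t} s∈ t∈ =
          -- x₀ s t stays in Xᵤ, so it equals x₀ r for some r in T; cancelling x₀ gives s t = r.
          let r , r∈ , eq = X⊆x₀T (TX⊆X t∈ (TX⊆X s∈ x₀∈))
          in respect T {r} {s * t} (*-cancelˡ-≉0 x₀≉0 (trans eq (*-assoc x₀ s t))) r∈

open import Data.Nat.Base using (_+_; _*_; _^_; _≥_; _>_)

theorem2p10 : ∀ {c ℓ} (𝔽 : Field c ℓ) (q n k : ℕ) →
    let open Geometry 𝔽 in
    IsPrimePower q → n ≥ 1 → q > 2 → k ∣ n →
    HasSize (Field.setoid 𝔽) (q ^ n) →
    (𝔽q 𝔽qᵏ : Subfield 𝔽) →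
    HasSize (elements (Subfield.subset 𝔽q)) q →
    HasSize (elements (Subfield.subset 𝔽qᵏ)) (q ^ k) →
    let open H∞ 𝔽q in
    (S : Subset pointSets (c ⊔ ℓ)) →
    S ⊆ 𝒟 → HasSize (elements S) (q ^ k + 1) →
    let
      condition₁ = Σ[ m ∈ Subset PG₂ (c ⊔ ℓ) ] IsSubline 𝔽qᵏ m × m ⊆ l∞ × S ≐ φ[ m ]
      condition₂ = ∀ A B C → A ∈ S → B ∈ S → C ∈ S → PairwiseDistinct A B C →
        Σ[ R! ∈ ∃! _≐_ (IsRegulusThrough q n A B C) ] proj₁ R! ⊆ S
      condition₃ = Σ[ W ∈ PointSet ] W is⟨ 2 * k -1⟩-dimensional ×
        (∀ X → X ∈ S → W ∩ X is⟨ k -1⟩-dimensional)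
      condition₄ = Σ[ W ∈ PointSet ] W is⟨ 2 * k -1⟩-dimensional ×
        (∀ X → X ∈ S → W ∩ X is⟨ k -1⟩-dimensional × W ∩ X ∈ spread 𝔽qᵏ)
    in (condition₁ ⇔ condition₂) × (condition₂ ⇔ condition₃) × (condition₃ ⇔ condition₄)
theorem2p10 𝔽 q n k _ n≥1 q>2 k∣n |𝔽| 𝔽q 𝔽qᵏ |𝔽q| |𝔽qᵏ| S S⊆𝒟 |S| =
  -- Every arrow goes through `IsSublineImage` except the last, which only forgets membership in the
  -- finer spread.
  mk⇔ (image⇒condition₂ S ∘ condition₁⇒image S) (image⇒condition₁ S ∘ 2⇒image) ,
  mk⇔ (4⇒3 ∘ image⇒condition₄ S ∘ 2⇒image) (image⇒condition₂ S ∘ 3⇒image) ,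
  mk⇔ (image⇒condition₄ S ∘ 3⇒image) 4⇒3
  where
  k≥1 : k ≥ 1
  -- 0 divides only 0, whereas n ≥ 1.
  k≥1 = ℕ.n≢0⇒n>0 λ { ≡.refl → ℕ.<⇒≢ n≥1 (≡.sym (0∣⇒≡0 k∣n)) }
  open Conditions 𝔽 (finite⇒dec |𝔽|) 𝔽q 𝔽qᵏ {q} {n} {k} q>2 k≥1 |𝔽| |𝔽q| |𝔽qᵏ|
  |S|′ : HasSize (elements S) (ℕ.suc (q ^ k))
  |S|′ = ≡.subst (HasSize (elements S)) (ℕ.+-comm (q ^ k) 1) |S|
  open Coordinates (coordinates-exist S S⊆𝒟 |S|′)
  2⇒image : condition₂ S → IsSublineImage S
  2⇒image = condition₂⇒image S S⊆𝒟 |S|′ det≉0 u∈S v∈S u⊕v∈S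
  3⇒image : condition₃ S → IsSublineImage S
  3⇒image = condition₃⇒image S S⊆𝒟 |S|′ det≉0 u∈S v∈S u⊕v∈S
  4⇒3 : condition₄ S → condition₃ S
  4⇒3 (W , W-dim , section) = W , W-dim , λ X X∈S → proj₁ (section X X∈S)
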